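{- Let $n\in\mathbb{N}$, let $\lambda$ be a partition of $n$ and let $U\in\mathrm{SYT}(\lambda)$. Then for $1\le b\le n$ we have the recursion $$(n-b)\,m_U(b)=\alpha_\lambda-\omega_U(b)+\sum_{a=1}^{b-1}m_U(a).$$
   Context: A partition $\lambda=(\lambda_1\ge\lambda_2\ge\dots)$ of $n$ is identified with its Young diagram $\{(i,j): i\ge 1,\ 1\le j\le\lambda_i\}$ (English convention: row $i$, column $j$). A tableau of shape $\lambda$ is a bijection $T:\lambda\to\{1,\dots,n\}$; $\mathrm{T}(\lambda)$ is the set of all tableaux. $\mathrm{SYT}(\lambda)\subseteq \mathrm{T}(\lambda)$ is the set of standard Young tableaux, i.e. tableaux increasing along rows from left to right and along columns from top to bottom. For a cell $x=(i,j)\in\lambda$ put $N_\lambda^+(x)=\{(i+1,j),(i,j+1)\}\cap\lambda$ and define its height $h'_\lambda(x)=(i-1)+(j-1)$. For an entry $a$ and a tableau $T$ put $h'(a,T)=h'_\lambda(T^{ -1}(a))$. Novelli--Pak--Stoyanovskii algorithm corresponding to $U\in\mathrm{SYT}(\lambda)$: order the cells by $x\prec_U y :\Leftrightarrow U(x)<U(y)$. Given $T\in\mathrm{T}(\lambda)$ set $T_0=T$. If $T_s$ is not a standard Young tableau, let $x$ be the $\prec_U$-maximal cell with $N_\lambda^+(x)\neq\emptyset$ and $T_s(x)>\min\{T_s(y):y\in N_\lambda^+(x)\}$, and let $T_{s+1}$ be obtained from $T_s$ by exchanging the entry $T_s(x)$ with the entry $\min\{T_s(y):y\in N_\lambda^+(x)\}$.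 The process stops at the first tableau $T_r$ which is standard; write $r_U(T)=r$ and $\varphi_U(T)=T_r$. Exchange numbers: for $1\le a<b\le n$ let $m_U(a,b)$ be the number of tableaux $T\in\mathrm{T}(\lambda)$ such that the entries $a$ and $b$ are exchanged with each other at some step of the algorithm applied to $T$ (for each $T$ this happens at most once). It is known that $m_U(a,b)$ does not depend on the choice of $b>a$, and one writes $m_U(a)=m_U(a,b)$ for any $b$ with $a<b\le n$. (For $b=n$ the number $m_U(n)$ is not defined in this way; the product $(n-n)\,m_U(n)$ is read as $0$.) Total initial height: $\alpha_\lambda=\sum_{T\in\mathrm{T}(\lambda)}h'(b,T)$, which is independent of $b$ and equals $(n-1)!\sum_{x\in\lambda}h'_\lambda(x)$. Total terminal height: $\omega_U(b)=\sum_{T\in\mathrm{T}(\lambda)}h'(b,\varphi_U(T))$. -}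

module Defs where

open import Data.Fin as Fin using (Fin; zero; suc; toℕ; fromℕ<; inject≤; punchIn; punchOut)
import Data.Fin.Properties as Fin
open import Data.Fin.Permutation using (Permutation′; insert; transpose; cast-id)
import Data.Fin.Permutation as Perm
import Data.Fin.Permutation.Components as PC
open import Data.List using (List; []; _∷_; map; concatMap; filter; length; lookup; allFin)
import Data.List.Extrema as Extrema
open import Data.List.Membership.Propositional using (_∈_)
open import Data.List.Membership.Propositional.Properties
  using (∈-filter⁺; ∈-filter⁻; ∈-concatMap⁺; ∈-map⁺; ∈-allFin)
import Data.List.Relation.Unary.All as All
import Data.List.Relation.Unary.Any as Any
open import Data.List.Relation.Unary.Linked using (Linked; _∷_)
open import Data.Maybe as Maybe using (Maybe; just; nothing; maybe′; _>>=_)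
import Data.Maybe.Relation.Unary.Any as MaybeAny
open import Data.Nat using (ℕ; zero; suc; _+_; _*_; _∸_; _≤_; _<_; _≥_; z≤n; s≤s; _≟_; _<?_)
open import Data.Nat.ListAction using (sum)
open import Data.Nat.Properties
open import Data.Product using (Σ; ∃-syntax; ∃₂; _×_; _,_; proj₁; proj₂)
open import Data.Sum using (_⊎_; inj₁; inj₂)
open import Data.Vec.Functional using (removeAt)
open import Algebra.Properties.CommutativeMonoid.Sum +-0-commutativeMonoid
  using (sum-remove; sum-cong-≗) renaming (sum to ∑)
open import Function using (_∘_; _↔_; Inverse; mk↔ₛ′)
open import Function.Construct.Composition using (_↔-∘_)
open import Relation.Binary.Definitions using (tri<; tri≈; tri>)
open import Relation.Binary.PropositionalEquality
open import Relation.Nullary using (¬_; Dec; yes; no; contradiction)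
open import Relation.Nullary.Decidable
  using (map′; _×-dec_; _⊎-dec_; _→-dec_; dec-true; dec-false)

open Inverse using (to; from; strictlyInverseˡ; strictlyInverseʳ)

record Partition (n : ℕ) : Set where
  field
    parts      : List ℕ
    decreasing : Linked _≥_ parts
    positive   : All.All (0 <_) parts
    size       : sum parts ≡ n

open Partition public

-- Rows and columns are counted from 0: the cell (i+1, j+1) has row i and column j.
record Cell {n : ℕ} (μ : Partition n) : Set where
  constructor cell
  field
    rowIx : Fin (length (parts μ))
    colIx : Fin (lookup (parts μ) rowIx)

  row col height : ℕ
  row    = toℕ rowIx
  col    = toℕ colIx
  height = row + col

open Cell public using (row; col; height)

cells : ∀ {n} (μ : Partition n) → List (Cell μ)
cells μ = concatMap (λ i → map (cell i) (allFin (lookup (parts μ) i)))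
                    (allFin (length (parts μ)))

rowReading : ∀ ps → Σ (Fin (length ps)) (Fin ∘ lookup ps) ↔ Fin (sum ps)
rowReading []       = mk↔ₛ′ (λ ()) (λ ()) (λ ()) (λ ())
rowReading (p ∷ ps) = mk↔ₛ′ f (g′ ∘ Fin.splitAt p) f∘g g∘f
  where
  rest = rowReading ps
  f : Σ (Fin (suc (length ps))) (Fin ∘ lookup (p ∷ ps)) → Fin (p + sum ps)
  f (zero  , j) = j Fin.↑ˡ sum ps
  f (suc i , j) = p Fin.↑ʳ to rest (i , j)
  down : Σ (Fin (length ps)) (Fin ∘ lookup ps) →
         Σ (Fin (suc (length ps))) (Fin ∘ lookup (p ∷ ps))
  down (i , j) = suc i , j
  g′ : Fin p ⊎ Fin (sum ps) → Σ (Fin (suc (length ps))) (Fin ∘ lookup (p ∷ ps))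
  g′ (inj₁ j) = zero , j
  g′ (inj₂ k) = down (from rest k)
  f∘g′ : ∀ s → f (g′ s) ≡ Fin.join p (sum ps) s
  f∘g′ (inj₁ j) = refl
  f∘g′ (inj₂ k) = cong (p Fin.↑ʳ_) (strictlyInverseˡ rest k)
  f∘g : ∀ k → f (g′ (Fin.splitAt p k)) ≡ k
  f∘g k = trans (f∘g′ (Fin.splitAt p k)) (Fin.join-splitAt p (sum ps) k)
  g∘f : ∀ x → g′ (Fin.splitAt p (f x)) ≡ x
  g∘f (zero  , j) = cong g′ (Fin.splitAt-↑ˡ p j (sum ps))
  g∘f (suc i , j) = trans (cong g′ (Fin.splitAt-↑ʳ p (sum ps) (to rest (i , j))))
                          (cong down (strictlyInverseʳ rest (i , j)))

-- Lists each permutation of Fin n exactly once: a permutation of Fin (suc n) is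
-- determined by the image j of zero and by what it does to the other elements.
permutations : ∀ n → List (Permutation′ n)
permutations zero    = Perm.id ∷ []
permutations (suc n) = concatMap (λ j → map (insert zero j) (permutations n)) (allFin (suc n))

leastBy greatestBy : ∀ {A : Set} {n} → (A → Fin n) → List A → Maybe A
leastBy    f []       = nothing
leastBy    f (x ∷ xs) = just (Extrema.argmin (Fin.≤-totalOrder _) f x xs)
greatestBy f []       = nothing
greatestBy f (x ∷ xs) = just (Extrema.argmax (Fin.≤-totalOrder _) f x xs)

module _ {n : ℕ} where

  -- The element k of Fin n stands for the entry toℕ k + 1 of {1,…,n}.
  Tableau : Partition n → Set
  Tableau μ = Cell μ ↔ Fin n

  -- Every bijection from the cells to Fin n is the row reading followed by a
  -- unique permutation, so each tableau occurs exactly once (up to pointwise equality).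
  tableaux : ∀ μ → List (Tableau μ)
  tableaux μ = map (_↔-∘ rowByRow) (permutations n)
    where
    rowByRow : Tableau μ
    rowByRow = cast-id (size μ) ↔-∘ (rowReading (parts μ) ↔-∘
      mk↔ₛ′ (λ (cell i j) → i , j) (λ (i , j) → cell i j) (λ _ → refl) (λ _ → refl))

  module _ {μ : Partition n} where

    Below RightOf : Cell μ → Cell μ → Set
    Below   y x = row y ≡ suc (row x) × col y ≡ col x
    RightOf y x = row y ≡ row x × col y ≡ suc (col x)

    Neighbour : Cell μ → Cell μ → Set
    Neighbour x y = Below y x ⊎ RightOf y x

    neighbour? : ∀ x y → Dec (Neighbour x y)
    neighbour? x y = ((row y ≟ suc (row x)) ×-dec (col y ≟ col x))
               ⊎-dec ((row y ≟ row x) ×-dec (col y ≟ suc (col x)))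

    N⁺ : Cell μ → List (Cell μ)
    N⁺ x = filter (neighbour? x) (cells μ)

    Standard : Tableau μ → Set
    Standard T = ∀ x y → (row x ≡ row y × col x < col y) ⊎ (col x ≡ col y × row x < row y) →
                 to T x Fin.< to T y

    standard? : ∀ T → Dec (Standard T)
    standard? T = all? λ x → all? λ y →
      (((row x ≟ row y) ×-dec (col x <? col y)) ⊎-dec ((col x ≟ col y) ×-dec (row x <? row y)))
      →-dec (to T x Fin.<? to T y)
      where
      all? : ∀ {P : Cell μ → Set} → (∀ x → Dec (P x)) → Dec (∀ x → P x)
      all? P? = map′ (λ f (cell i j) → f i j) (λ f i j → f (cell i j))
                     (Fin.all? λ i → Fin.all? λ j → P? (cell i j))

    entryHeight : Fin n → Tableau μ → ℕ
    entryHeight a T = height (from T a)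

    minNeighbour : Tableau μ → Cell μ → Maybe (Cell μ)
    minNeighbour T x = leastBy (to T) (N⁺ x)

    Violation : Tableau μ → Cell μ → Set
    Violation T x = MaybeAny.Any (λ y → to T y Fin.< to T x) (minNeighbour T x)

    violation? : ∀ T x → Dec (Violation T x)
    violation? T x = MaybeAny.dec (λ y → to T y Fin.<? to T x) (minNeighbour T x)

    maxViolation : (U T : Tableau μ) → Maybe (Cell μ)
    maxViolation U T = greatestBy (to U) (filter (violation? T) (cells μ))

    -- The pair (x , y) with T x the larger of the two entries exchanged next.
    nextExchange : (U T : Tableau μ) → Maybe (Cell μ × Cell μ)
    nextExchange U T = maxViolation U T >>= λ x → Maybe.map (x ,_) (minNeighbour T x)

    exchange : Cell μ → Cell μ → Tableau μ → Tableau μ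
    exchange x y T = transpose (to T x) (to T y) ↔-∘ T

    -- T₀, T₁, T₂, …; the algorithm runs through this sequence up to the first
    -- standard tableau.
    steps : (U T : Tableau μ) → ℕ → Tableau μ
    steps U T zero    = T
    steps U T (suc s) = maybe′ (λ (x , y) → exchange x y Tₛ) Tₛ (nextExchange U Tₛ)
      where Tₛ = steps U T s

-- Termination: an exchange moves the larger of two entries one step away from the
-- corner and the smaller one a step towards it, so Σ (entry × height), which is
-- bounded, increases as long as T_s is not standard.

∈-cells : ∀ {n} {μ : Partition n} (x : Cell μ) → x ∈ cells μ
∈-cells (cell i j) =
  ∈-concatMap⁺ _ (Any.map (λ { refl → ∈-map⁺ (cell i) (∈-allFin j) }) (∈-allFin i))

leastBy-≤ : ∀ {A : Set} {n} (f : A → Fin n) {xs y} → y ∈ xs →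
            ∃[ z ] leastBy f xs ≡ just z × f z Fin.≤ f y
leastBy-≤ f {x ∷ xs} (Any.here refl) = _ , refl , E.f[argmin]≤f[⊤] {f = f} x xs
  where module E = Extrema (Fin.≤-totalOrder _)
leastBy-≤ f {x ∷ xs} (Any.there y∈)  = _ , refl , All.lookup (E.f[argmin]≤f[xs] {f = f} x xs) y∈
  where module E = Extrema (Fin.≤-totalOrder _)

leastBy-∈ : ∀ {A : Set} {n} (f : A → Fin n) {xs z} → leastBy f xs ≡ just z → z ∈ xs
leastBy-∈ f {x ∷ xs} refl with Extrema.argmin-sel (Fin.≤-totalOrder _) f x xs
... | inj₁ eq = Any.here eq
... | inj₂ m  = Any.there m

greatestBy-∈ : ∀ {A : Set} {n} (f : A → Fin n) {xs z} → greatestBy f xs ≡ just z → z ∈ xs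
greatestBy-∈ f {x ∷ xs} refl with Extrema.argmax-sel (Fin.≤-totalOrder _) f x xs
... | inj₁ eq = Any.here eq
... | inj₂ m  = Any.there m

greatestBy-just : ∀ {A : Set} {n} (f : A → Fin n) {xs y} → y ∈ xs → ∃[ z ] greatestBy f xs ≡ just z
greatestBy-just f {x ∷ xs} _ = _ , refl

lookup-≥ : ∀ {ps} → Linked _≥_ ps → (k i : Fin (length ps)) → toℕ i ≡ suc (toℕ k) →
           lookup ps i ≤ lookup ps k
lookup-≥ (p≥q ∷ _)  zero    (suc zero) _  = p≥q
lookup-≥ (_ ∷ rest) (suc k) (suc i)    eq = lookup-≥ rest k i (suc-injective eq)

∑-<-at-two : ∀ {m} (f g : Fin m → ℕ) (i j : Fin m) → i ≢ j →
             (∀ k → k ≢ i → k ≢ j → f k ≡ g k) → f i + f j < g i + g j → ∑ f < ∑ g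
∑-<-at-two {suc zero}    f g zero zero i≢j _  _  = contradiction refl i≢j
∑-<-at-two {suc (suc m)} f g i    j    i≢j eq lt = begin-strict
  ∑ f                        ≡⟨ split f ⟩
  f i + f j + ∑ (rest f)     ≡⟨ cong (f i + f j +_) (sum-cong-≗ λ k →
                                  eq _ (Fin.punchInᵢ≢i i _) (≢j k)) ⟩
  f i + f j + ∑ (rest g)     <⟨ +-monoˡ-< _ lt ⟩
  g i + g j + ∑ (rest g)     ≡⟨ split g ⟨
  ∑ g                        ∎
  where
  open ≤-Reasoning
  j′ : Fin (suc m)
  j′ = punchOut i≢j
  rest : (Fin (suc (suc m)) → ℕ) → Fin m → ℕ
  rest h = removeAt (removeAt h i) j′
  at-j : punchIn i j′ ≡ j
  at-j = Fin.punchIn-punchOut i≢j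
  ≢j : ∀ k → punchIn i (punchIn j′ k) ≢ j
  ≢j k e = Fin.punchInᵢ≢i j′ k (Fin.punchIn-injective i _ _ (trans e (sym at-j)))
  split : ∀ h → ∑ h ≡ h i + h j + ∑ (rest h)
  split h = trans (sum-remove {i = i} h)
           (trans (cong (h i +_) (trans (sum-remove {i = j′} (removeAt h i))
                                        (cong (λ v → h v + ∑ (rest h)) at-j)))
                  (sym (+-assoc (h i) (h j) _)))

∑-≤ : ∀ {m} (f : Fin m → ℕ) b → (∀ k → f k ≤ b) → ∑ f ≤ m * b
∑-≤ {zero}  f b le = z≤n
∑-≤ {suc m} f b le = +-mono-≤ (le zero) (∑-≤ (f ∘ suc) b (le ∘ suc))

least : ∀ {P : ℕ → Set} → (∀ s → Dec (P s)) → ∀ k → P k →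
        ∃[ r ] P r × (∀ s → s < r → ¬ P s)
least P? zero    p = 0 , p , λ _ ()
least P? (suc k) p with P? 0
... | yes p₀ = 0 , p₀ , λ _ ()
... | no ¬p₀ with least (P? ∘ suc) k p
...   | r , pr , below = suc r , pr , λ { zero _ → ¬p₀ ; (suc s) (s≤s lt) → below s lt }

transpose-other : ∀ {n} (i j k : Fin n) → k ≢ i → k ≢ j → PC.transpose i j k ≡ k
transpose-other i j k k≢i k≢j rewrite dec-false (k Fin.≟ i) k≢i | dec-false (k Fin.≟ j) k≢j = refl

transpose-fst : ∀ {n} (i j : Fin n) → PC.transpose i j i ≡ j
transpose-fst i j rewrite dec-true (i Fin.≟ i) refl = refl

transpose-snd : ∀ {n} (i j : Fin n) → j ≢ i → PC.transpose i j j ≡ i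
transpose-snd i j j≢i rewrite dec-false (j Fin.≟ i) j≢i | dec-true (j Fin.≟ j) refl = refl

rearrangement : ∀ {a b} h → a < b → b * h + a * suc h < a * h + b * suc h
rearrangement {a} {b} h a<b = begin-strict
  b * h + a * suc h    ≡⟨ cong (b * h +_) (*-suc a h) ⟩
  b * h + (a + a * h)  ≡⟨ +-comm (b * h) _ ⟩
  a + a * h + b * h    <⟨ +-monoˡ-< (b * h) (+-monoˡ-< (a * h) a<b) ⟩
  b + a * h + b * h    ≡⟨ cong (_+ b * h) (+-comm b (a * h)) ⟩
  a * h + b + b * h    ≡⟨ +-assoc (a * h) b _ ⟩
  a * h + (b + b * h)  ≡⟨ cong (a * h +_) (*-suc b h) ⟨
  a * h + b * suc h    ∎
  where open ≤-Reasoning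

module _ {n : ℕ} {μ : Partition n} where

  neighbour-height : ∀ {x y : Cell μ} → Neighbour x y → height y ≡ suc (height x)
  neighbour-height         (inj₁ (r , c)) = cong₂ _+_ r c
  neighbour-height {x = x} (inj₂ (r , c)) = trans (cong₂ _+_ r c) (+-suc (row x) (col x))

  to-injective : (T : Tableau μ) → ∀ {x y} → to T x ≡ to T y → x ≡ y
  to-injective T {x} {y} eq =
    trans (sym (strictlyInverseʳ T x)) (trans (cong (from T) eq) (strictlyInverseʳ T y))

  no-violation⇒increasing : (T : Tableau μ) → (∀ x → ¬ Violation T x) →
                            ∀ (x y : Cell μ) → Neighbour x y → to T x Fin.< to T y
  no-violation⇒increasing T none x y nb with Fin.<-cmp (to T x) (to T y)
  ... | tri< lt _ _ = lt
  ... | tri≈ _ eq _ = contradiction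
        (trans (sym (neighbour-height {x} {y} nb)) (sym (cong height (to-injective T eq)))) 1+n≢n
  ... | tri> _ _ gt with leastBy-≤ (to T) (∈-filter⁺ (neighbour? x) (∈-cells y) nb)
  ...   | z , eq , le = contradiction
          (subst (MaybeAny.Any _) (sym eq) (MaybeAny.just (≤-<-trans le gt))) (none x)

  increasing⇒standard : (T : Tableau μ) → (∀ (x y : Cell μ) → Neighbour x y → to T x Fin.< to T y) →
                        Standard T
  increasing⇒standard T inc (cell i j) (cell i′ j′) (inj₁ (r , lt)) with Fin.toℕ-injective r
  ... | refl = along-row (proj₁ gap) j′ (proj₂ gap)
    where
    gap : ∃[ d ] toℕ j′ ≡ suc d + toℕ j
    gap = toℕ j′ ∸ suc (toℕ j) , trans (sym (m∸n+n≡m lt)) (+-suc _ _)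
    along-row : ∀ d (k : Fin (lookup (parts μ) i)) → toℕ k ≡ suc d + toℕ j →
                to T (cell i j) Fin.< to T (cell i k)
    along-row zero    k eq = inc _ _ (inj₂ (refl , eq))
    along-row (suc d) k eq = <-trans (along-row d l (Fin.toℕ-fromℕ< _))
                               (inc _ _ (inj₂ (refl , trans eq (cong suc (sym (Fin.toℕ-fromℕ< _))))))
      where
      l = fromℕ< {suc d + toℕ j} (<-trans (≤-reflexive (sym eq)) (Fin.toℕ<n k))
  increasing⇒standard T inc (cell i j) (cell i′ j′) (inj₂ (c , lt)) =
    along-column (proj₁ gap) i′ j′ (proj₂ gap) (sym c)
    where
    gap : ∃[ d ] toℕ i′ ≡ suc d + toℕ i
    gap = toℕ i′ ∸ suc (toℕ i) , trans (sym (m∸n+n≡m lt)) (+-suc _ _)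
    along-column : ∀ d k (l : Fin (lookup (parts μ) k)) → toℕ k ≡ suc d + toℕ i → toℕ l ≡ toℕ j →
                   to T (cell i j) Fin.< to T (cell k l)
    along-column zero    k l eq same = inc _ _ (inj₁ (eq , same))
    along-column (suc d) k l eq same =
      <-trans (along-column d k⁻ l⁻ (Fin.toℕ-fromℕ< _) (trans (Fin.toℕ-inject≤ l _) same))
              (inc _ _ (inj₁ (k≡ , sym (Fin.toℕ-inject≤ l _))))
      where
      k⁻ = fromℕ< {suc d + toℕ i} (<-trans (≤-reflexive (sym eq)) (Fin.toℕ<n k))
      k≡ : toℕ k ≡ suc (toℕ k⁻)
      k≡ = trans eq (cong suc (sym (Fin.toℕ-fromℕ< _)))
      l⁻ = inject≤ l (lookup-≥ (decreasing μ) k⁻ k k≡)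

  nextExchange-just : (U T : Tableau μ) → ¬ Standard T →
                      ∃₂ λ x y → nextExchange U T ≡ just (x , y) ×
                                 Neighbour x y × to T y Fin.< to T x
  nextExchange-just U T ¬std
    with maxViolation U T in eq
  ... | nothing = contradiction
        (increasing⇒standard T (no-violation⇒increasing T none)) ¬std
    where
    none : ∀ x → ¬ Violation T x
    none x v with greatestBy-just (to U) (∈-filter⁺ (violation? T) (∈-cells x) v)
    ... | z , eq′ with trans (sym eq) eq′
    ...   | ()
  ... | just x with minNeighbour T x in eqₓ
                  | proj₂ (∈-filter⁻ (violation? T) {xs = cells μ} (greatestBy-∈ (to U) eq))
  ...   | just y | MaybeAny.just lt =
          x , y , refl ,
          proj₂ (∈-filter⁻ (neighbour? x) {xs = cells μ} (leastBy-∈ (to T) eqₓ)) , lt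

  potential : Tableau μ → ℕ
  potential T = ∑ λ v → toℕ v * entryHeight v T

  exchange-potential : ∀ T x y → Neighbour x y → to T y Fin.< to T x →
                       potential T < potential (exchange x y T)
  exchange-potential T x y nb lt =
    ∑-<-at-two _ _ b a (λ b≡a → <⇒≢ lt (cong toℕ (sym b≡a)))
      (λ k k≢b k≢a → cong (λ v → toℕ k * entryHeight v T) (sym (transpose-other a b k k≢a k≢b)))
      (subst₂ _<_ (cong₂ _+_ (cong (toℕ b *_) (sym heightᵇ)) (cong (toℕ a *_) (sym heightᵃ)))
                  (trans (+-comm (toℕ a * height x) _)
                         (cong₂ _+_ (cong (toℕ b *_) (sym heightᵇ′)) (cong (toℕ a *_) (sym heightᵃ′))))
                  (rearrangement (height x) lt))
    where
    a = to T y
    b = to T x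
    h = height x
    b≢a : b ≢ a
    b≢a b≡a = <⇒≢ lt (cong toℕ (sym b≡a))
    heightᵇ : entryHeight b T ≡ h
    heightᵇ = cong height (strictlyInverseʳ T x)
    heightᵃ : entryHeight a T ≡ suc h
    heightᵃ = trans (cong height (strictlyInverseʳ T y)) (neighbour-height {x} {y} nb)
    heightᵇ′ : entryHeight b (exchange x y T) ≡ suc h
    heightᵇ′ = trans (cong (λ v → entryHeight v T) (transpose-snd a b b≢a)) heightᵃ
    heightᵃ′ : entryHeight a (exchange x y T) ≡ h
    heightᵃ′ = trans (cong (λ v → entryHeight v T) (transpose-fst a b)) heightᵇ

  potentialBound : ℕ
  potentialBound = n * (n * (length (parts μ) + sum (parts μ)))

  potential-≤ : ∀ T → potential T ≤ potentialBound
  potential-≤ T = ∑-≤ _ _ λ v →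
    *-mono-≤ (<⇒≤ (Fin.toℕ<n v)) (height-≤ (from T v))
    where
    lookup-≤-sum : ∀ ps (i : Fin (length ps)) → lookup ps i ≤ sum ps
    lookup-≤-sum (p ∷ ps) zero    = m≤m+n p _
    lookup-≤-sum (p ∷ ps) (suc i) = ≤-trans (lookup-≤-sum ps i) (m≤n+m _ p)
    height-≤ : ∀ (x : Cell μ) → height x ≤ length (parts μ) + sum (parts μ)
    height-≤ (cell i j) = +-mono-≤ (<⇒≤ (Fin.toℕ<n i))
      (≤-trans (<⇒≤ (Fin.toℕ<n j)) (lookup-≤-sum (parts μ) i))

  eventually-standard : ∀ (U T : Tableau μ) → ∃[ s ] Standard (steps U T s)
  eventually-standard U T with grow (suc potentialBound)
    where
    grow : ∀ s → (∃[ s′ ] Standard (steps U T s′)) ⊎ s ≤ potential (steps U T s)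
    grow zero    = inj₂ z≤n
    grow (suc s) with grow s
    ... | inj₁ found = inj₁ found
    ... | inj₂ le with standard? (steps U T s)
    ...   | yes std = inj₁ (s , std)
    ...   | no ¬std with nextExchange-just U (steps U T s) ¬std
    ...     | x , y , eq , nb , lt rewrite eq =
              inj₂ (≤-<-trans le (exchange-potential (steps U T s) x y nb lt))
  ... | inj₁ found = found
  ... | inj₂ le    = contradiction (≤-trans le (potential-≤ (steps U T (suc potentialBound)))) 1+n≰n

  firstStandard : ∀ (U T : Tableau μ) →
                  ∃[ r ] Standard (steps U T r) × (∀ s → s < r → ¬ Standard (steps U T s))
  firstStandard U T with eventually-standard U T
  ... | s , std = least (λ s′ → standard? (steps U T s′)) s std

  stoppingTime : (U T : Tableau μ) → ℕ
  stoppingTime U T = proj₁ (firstStandard U T)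

  φ : (U T : Tableau μ) → Tableau μ
  φ U T = steps U T (stoppingTime U T)

  Swapped : (T : Tableau μ) (a b : Fin n) → Cell μ × Cell μ → Set
  Swapped T a b (x , y) = (to T x ≡ a × to T y ≡ b) ⊎ (to T x ≡ b × to T y ≡ a)

  swapped? : ∀ T a b xy → Dec (Swapped T a b xy)
  swapped? T a b (x , y) = ((to T x Fin.≟ a) ×-dec (to T y Fin.≟ b))
                     ⊎-dec ((to T x Fin.≟ b) ×-dec (to T y Fin.≟ a))

  -- The entries a and b are exchanged when passing from T_s to T_{s+1}.
  ExchangedAt : (U T : Tableau μ) (a b : Fin n) → ℕ → Set
  ExchangedAt U T a b s =
    MaybeAny.Any (Swapped (steps U T s) a b) (nextExchange U (steps U T s))

  Exchanged : (U : Tableau μ) (a b : Fin n) → Tableau μ → Set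
  Exchanged U a b T = ∃[ s ] s < stoppingTime U T × ExchangedAt U T a b s

  exchanged? : ∀ U a b T → Dec (Exchanged U a b T)
  exchanged? U a b T = anyUpTo?
    (λ s → MaybeAny.dec (swapped? (steps U T s) a b) (nextExchange U (steps U T s)))
    (stoppingTime U T)

  -- The two-argument number m_U(a, b).
  exchangeNumber : (U : Tableau μ) (a b : Fin n) → ℕ
  exchangeNumber U a b = length (filter (exchanged? U a b) (tableaux μ))

  terminalHeight : (U : Tableau μ) (b : Fin n) → ℕ
  terminalHeight U b = sum (map (λ T → entryHeight b (φ U T)) (tableaux μ))

initialHeight : ∀ {n} (μ : Partition n) (b : Fin n) → ℕ
initialHeight μ b = sum (map (entryHeight b) (tableaux μ))

module Submission where

-- Why the recursion holds. Follow the height of a fixed entry b through one run of the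
-- algorithm. An exchange with a smaller entry a < b increases the height of b by one,
-- an exchange with a larger entry c > b decreases it by one, and other exchanges leave
-- it alone. If no pair of entries is exchanged twice, then for each tableau T
--
--   h(b, φ T) + #{c > b : b, c exchanged} = h(b, T) + #{a < b : a, b exchanged}
--
-- (balance). Summing over T gives ω(b) + Σ_{c>b} m(b,c) = α + Σ_{a<b} m(a,b)
-- (total-balance), and the recursion follows since m(b,c) does not depend on c > b
-- (exchangeNumber-independent) and α does not depend on the entry used to compute it
-- (initialHeight-independent).
--
-- The run is controlled by an invariant (Travelling): while an entry travels from its
-- starting cell, all cells not before that cell in the order of U are in order, except
-- possibly at the current position x of the traveller, and the neighbours on either side
-- of x are in order with each other. Hence the entries passed by a traveller increase
-- (passes-increase), and an entry that has come to rest never travels again (at-rest).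
-- In particular each pair is exchanged at most once (passes-once).
--
-- For the independence, let p and q be consecutive values, both greater than a, and let
-- T′ arise from T by interchanging p and q. If p passes a at step s of the run from T,
-- then q passes a at step s of the run from T′ (Passes-∼). Indeed, the runs could only
-- part, up to the relabelling, by comparing p with q, either while p rests, or with p
-- travelling and passing q; after that p passes no entry smaller than q, so not a.
-- So interchanging p and q is a bijection which shows m(a,p) = m(a,q).

open import Defs
open import Data.Nat using (ℕ; suc; _∸_; _*_) renaming (_<_ to _<ℕ_)
open import Data.Nat.ListAction using (sum)
open import Data.Fin using (Fin; zero; suc; toℕ; _<_)
open import Data.Fin.Properties using (_<?_)
open import Data.List using (List; []; _∷_; map; filter; allFin; concatMap; length; tabulate)
open import Relation.Binary.PropositionalEquality
open import Data.Bool using (if_then_else_)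
open import Data.Product using (∃-syntax; ∃₂; _×_; _,_; proj₁; proj₂)
open import Data.Sum using (_⊎_; inj₁; inj₂; swap)
open import Function using (_∘_; id; Inverse; mk↔ₛ′)
open import Function.Construct.Composition using (_↔-∘_)
open import Relation.Nullary using (¬_; Dec; yes; no; does; contradiction)
open import Relation.Nullary.Decidable using (_×-dec_)
import Data.Fin as Fin
import Data.Fin.Properties as Fin
import Data.Fin.Permutation as Perm
import Data.Fin.Permutation.Components as PC
import Data.Nat as ℕ
import Data.Nat.Properties as ℕ
import Data.List.Extrema as Extrema
open import Data.List.Membership.Propositional using (_∈_)
open import Data.List.Membership.Propositional.Properties using (∈-filter⁺; ∈-filter⁻)
import Data.List.Relation.Unary.All as All
open import Data.List.Relation.Unary.Any using (here; there)
open import Data.Maybe using (just; nothing)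
open import Data.Maybe.Properties using (just-injective)
import Data.Maybe.Relation.Unary.Any as MaybeAny
open import Relation.Binary.Definitions using (tri<; tri≈; tri>)
open import Data.Integer.Tactic.RingSolver using (solve-∀)

open Inverse using (to; from; strictlyInverseˡ; strictlyInverseʳ)

-- Finite sums, and sums over all tableaux

module Sums where

  open import Data.Nat using (_+_)
  open import Data.List using (_++_)
  open import Data.List.Properties using (map-∘; map-cong; map-++)
  open import Data.Nat.ListAction.Properties using (sum-++)
  open import Algebra.Properties.CommutativeMonoid.Sum ℕ.+-0-commutativeMonoid public
    using (∑-distrib-+; ∑-comm; sum-permute; sum-cong-≗; sum-remove) renaming (sum to ∑)

  -- The sum of f over the elements of a list, with multiplicity.
  Σ[_] : ∀ {A : Set} → List A → (A → ℕ) → ℕ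
  Σ[ xs ] f = sum (map f xs)

  Σ-cong : ∀ {A : Set} (xs : List A) {f g : A → ℕ} → (∀ x → f x ≡ g x) → Σ[ xs ] f ≡ Σ[ xs ] g
  Σ-cong xs eq = cong sum (map-cong eq xs)

  Σ-+ : ∀ {A : Set} (xs : List A) (f g : A → ℕ) → Σ[ xs ] (λ x → f x + g x) ≡ Σ[ xs ] f + Σ[ xs ] g
  Σ-+ []       f g = refl
  Σ-+ (x ∷ xs) f g = begin
    f x + g x + Σ[ xs ] (λ x → f x + g x)    ≡⟨ cong (f x + g x +_) (Σ-+ xs f g) ⟩
    f x + g x + (Σ[ xs ] f + Σ[ xs ] g)      ≡⟨ interchange (f x) (g x) _ _ ⟩
    f x + Σ[ xs ] f + (g x + Σ[ xs ] g)      ∎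
    where
    open ≡-Reasoning
    open import Algebra.Properties.CommutativeSemigroup ℕ.+-commutativeSemigroup using (interchange)

  Σ-* : ∀ {A : Set} (xs : List A) k (f : A → ℕ) → Σ[ xs ] (λ x → k * f x) ≡ k * Σ[ xs ] f
  Σ-* []       k f = sym (ℕ.*-zeroʳ k)
  Σ-* (x ∷ xs) k f = trans (cong (k * f x +_) (Σ-* xs k f)) (sym (ℕ.*-distribˡ-+ k (f x) _))

  Σ-∑-comm : ∀ {A : Set} {n} (xs : List A) (f : A → Fin n → ℕ) →
             Σ[ xs ] (λ x → ∑ (f x)) ≡ ∑ (λ i → Σ[ xs ] (λ x → f x i))
  Σ-∑-comm {n = n} [] f = sym (zeros n)
    where
    zeros : ∀ n → ∑ {n} (λ _ → 0) ≡ 0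
    zeros ℕ.zero  = refl
    zeros (suc n) = zeros n
  Σ-∑-comm (x ∷ xs) f =
    trans (cong (∑ (f x) +_) (Σ-∑-comm xs f)) (sym (∑-distrib-+ (f x) _))

  Σ-concatMap-allFin : ∀ {A : Set} {n} (f : A → ℕ) (g : Fin n → List A) →
                       Σ[ concatMap g (allFin n) ] f ≡ ∑ (λ j → Σ[ g j ] f)
  Σ-concatMap-allFin f g = go f g id
    where
    go : ∀ {A : Set} {n m} (f : A → ℕ) (g : Fin n → List A) (h : Fin m → Fin n) →
         Σ[ concatMap g (tabulate h) ] f ≡ ∑ (λ j → Σ[ g (h j) ] f)
    go {m = ℕ.zero} f g h = refl
    go {m = suc m}  f g h = begin
      sum (map f (g (h zero) ++ concatMap g (tabulate (h ∘ suc))))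
        ≡⟨ cong sum (map-++ f (g (h zero)) _) ⟩
      sum (map f (g (h zero)) ++ map f (concatMap g (tabulate (h ∘ suc))))
        ≡⟨ sum-++ (map f (g (h zero))) _ ⟩
      Σ[ g (h zero) ] f + Σ[ concatMap g (tabulate (h ∘ suc)) ] f
        ≡⟨ cong (Σ[ g (h zero) ] f +_) (go f g (h ∘ suc)) ⟩
      Σ[ g (h zero) ] f + ∑ (λ j → Σ[ g (h (suc j)) ] f) ∎
      where open ≡-Reasoning

  ∑-zero : ∀ {n} (f : Fin n → ℕ) → (∀ i → f i ≡ 0) → ∑ f ≡ 0
  ∑-zero {ℕ.zero} f f≡0 = refl
  ∑-zero {suc n}  f f≡0 = cong₂ _+_ (f≡0 zero) (∑-zero (f ∘ suc) (f≡0 ∘ suc))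

  ∑-single : ∀ {n} (f : Fin n → ℕ) i → (∀ k → k ≢ i → f k ≡ 0) → ∑ f ≡ f i
  ∑-single {suc n} f i f≡0 = begin
    ∑ f                            ≡⟨ sum-remove {i = i} f ⟩
    f i + ∑ (f ∘ Fin.punchIn i)    ≡⟨ cong (f i +_) (∑-zero _ λ k → f≡0 _ (Fin.punchInᵢ≢i i k)) ⟩
    f i + 0                        ≡⟨ ℕ.+-identityʳ _ ⟩
    f i                            ∎
    where open ≡-Reasoning

  telescope : (h f g : ℕ → ℕ) → ∀ r → (∀ t → t <ℕ r → h (suc t) + f t ≡ h t + g t) →
              h r + ∑ {r} (f ∘ toℕ) ≡ h 0 + ∑ {r} (g ∘ toℕ)
  telescope h f g ℕ.zero  step = refl
  telescope h f g (suc r) step = begin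
    h (suc r) + (f 0 + F)      ≡⟨ x∙yz≈y∙xz (h (suc r)) (f 0) F ⟩
    f 0 + (h (suc r) + F)      ≡⟨ cong (f 0 +_) (telescope (h ∘ suc) (f ∘ suc) (g ∘ suc) r
                                    λ t t<r → step (suc t) (ℕ.s≤s t<r)) ⟩
    f 0 + (h 1 + G)            ≡⟨ x∙yz≈yx∙z (f 0) (h 1) G ⟩
    h 1 + f 0 + G              ≡⟨ cong (_+ G) (step 0 (ℕ.s≤s ℕ.z≤n)) ⟩
    h 0 + g 0 + G              ≡⟨ ℕ.+-assoc (h 0) (g 0) G ⟩
    h 0 + (g 0 + G)            ∎
    where
    open ≡-Reasoning
    open import Algebra.Properties.CommutativeSemigroup ℕ.+-commutativeSemigroup
      using (x∙yz≈y∙xz; x∙yz≈yx∙z)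
    F = ∑ {r} (f ∘ suc ∘ toℕ)
    G = ∑ {r} (g ∘ suc ∘ toℕ)

  -- The indicator of a decidable proposition.
  ⟦_⟧ : ∀ {P : Set} → Dec P → ℕ
  ⟦ P? ⟧ = if does P? then 1 else 0

  ⟦⟧-yes : ∀ {P : Set} (P? : Dec P) → P → ⟦ P? ⟧ ≡ 1
  ⟦⟧-yes (yes _) p = refl
  ⟦⟧-yes (no ¬p) p = contradiction p ¬p

  ⟦⟧-no : ∀ {P : Set} (P? : Dec P) → ¬ P → ⟦ P? ⟧ ≡ 0
  ⟦⟧-no (yes p) ¬p = contradiction p ¬p
  ⟦⟧-no (no _)  ¬p = refl

  ⟦⟧-cong : ∀ {P Q : Set} (P? : Dec P) (Q? : Dec Q) → (P → Q) → (Q → P) → ⟦ P? ⟧ ≡ ⟦ Q? ⟧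
  ⟦⟧-cong (yes p) Q? f g = sym (⟦⟧-yes Q? (f p))
  ⟦⟧-cong (no ¬p) Q? f g = sym (⟦⟧-no Q? (¬p ∘ g))

  ⟦⟧-× : ∀ {P Q : Set} (P? : Dec P) (Q? : Dec Q) → ⟦ P? ×-dec Q? ⟧ ≡ ⟦ P? ⟧ * ⟦ Q? ⟧
  ⟦⟧-× (yes p) Q? = sym (ℕ.+-identityʳ _)
  ⟦⟧-× (no ¬p) Q? = refl

  ⟦⟧-*-cong : ∀ {P : Set} (P? : Dec P) {k m} → (P → k ≡ m) → ⟦ P? ⟧ * k ≡ ⟦ P? ⟧ * m
  ⟦⟧-*-cong (yes p) k≡m = cong (1 *_) (k≡m p)
  ⟦⟧-*-cong (no _)  k≡m = refl

  length-filter : ∀ {A : Set} {P : A → Set} (P? : ∀ x → Dec (P x)) xs →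
                  length (filter P? xs) ≡ Σ[ xs ] (λ x → ⟦ P? x ⟧)
  length-filter P? []       = refl
  length-filter P? (x ∷ xs) with P? x
  ... | yes _ = cong suc (length-filter P? xs)
  ... | no _  = length-filter P? xs

  Σ-filter-allFin : ∀ {n} {P : Fin n → Set} (P? : ∀ i → Dec (P i)) (f : Fin n → ℕ) →
                    Σ[ filter P? (allFin n) ] f ≡ ∑ (λ i → ⟦ P? i ⟧ * f i)
  Σ-filter-allFin P? f = go id
    where
    go : ∀ {m} (h : Fin m → Fin _) →
         Σ[ filter P? (tabulate h) ] f ≡ ∑ (λ i → ⟦ P? (h i) ⟧ * f (h i))
    go {ℕ.zero} h = refl
    go {suc m}  h with P? (h zero)
    ... | yes _ = cong₂ _+_ (sym (ℕ.+-identityʳ _)) (go (h ∘ suc))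
    ... | no _  = go (h ∘ suc)

  ∑-const : ∀ n k → ∑ {n} (λ _ → k) ≡ n * k
  ∑-const ℕ.zero  k = refl
  ∑-const (suc n) k = cong (k +_) (∑-const n k)

  -- There are n - 1 - b elements c > b of Fin n.
  ∑-above : ∀ {n} (b : Fin n) m → ∑ {n} (λ c → ⟦ b <? c ⟧ * m) ≡ (n ∸ suc (toℕ b)) * m
  ∑-above {suc n} zero    m = trans (sum-cong-≗ {n} {λ _ → 1 * m} λ _ → ℕ.*-identityˡ m) (∑-const n m)
  ∑-above {suc n} (suc b) m = ∑-above {n} b m

  -- Left composition with a fixed permutation σ only reorders the permutations: it
  -- sends the one with 0 ↦ j and remainder π to the one with 0 ↦ σ j and remainder
  -- (remove j σ) ∘ π.
  Σ-permutations : ∀ n (f : Perm.Permutation′ n → ℕ) → (∀ π ρ → π Perm.≈ ρ → f π ≡ f ρ) →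
                   ∀ σ → Σ[ permutations n ] (λ π → f (σ ↔-∘ π)) ≡ Σ[ permutations n ] f
  Σ-permutations ℕ.zero  f f-cong σ = cong (_+ 0) (f-cong (σ ↔-∘ Perm.id) Perm.id λ ())
  Σ-permutations (suc n) f f-cong σ = begin
    Σ[ permutations (suc n) ] (λ π → f (σ ↔-∘ π))              ≡⟨ split (λ π → f (σ ↔-∘ π)) ⟩
    ∑ (λ j → Σ[ P ] (λ π → f (σ ↔-∘ Perm.insert zero j π)))
      ≡⟨ sum-cong-≗ {suc n} (λ j → Σ-cong P λ π →
           f-cong (σ ↔-∘ Perm.insert zero j π) (image j π) (commute j π)) ⟩
    ∑ (λ j → Σ[ P ] (λ π → g (to σ j) (Perm.remove j σ ↔-∘ π)))
      ≡⟨ sum-cong-≗ {suc n} (λ j → Σ-permutations n (g (to σ j))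
           (λ π ρ π≈ρ → f-cong (Perm.insert zero (to σ j) π) (Perm.insert zero (to σ j) ρ)
                          (insert-cong (to σ j) π ρ π≈ρ)) (Perm.remove j σ)) ⟩
    ∑ (λ j → Σ[ P ] (g (to σ j)))                              ≡⟨ sum-permute (λ j → Σ[ P ] (g j)) σ ⟨
    ∑ (λ j → Σ[ P ] (g j))                                     ≡⟨ split f ⟨
    Σ[ permutations (suc n) ] f                                ∎
    where
    open ≡-Reasoning
    P = permutations n
    g : Fin (suc n) → Perm.Permutation′ n → ℕ
    g j π = f (Perm.insert zero j π)
    split : ∀ h → Σ[ permutations (suc n) ] h ≡ ∑ (λ j → Σ[ P ] (λ π → h (Perm.insert zero j π)))
    split h = trans (Σ-concatMap-allFin h (λ j → map (Perm.insert zero j) P))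
                    (sum-cong-≗ {suc n} λ j → cong sum (sym (map-∘ {g = h} {Perm.insert zero j} P)))
    insert-cong : ∀ j (π ρ : Perm.Permutation′ n) → π Perm.≈ ρ →
                  Perm.insert zero j π Perm.≈ Perm.insert zero j ρ
    insert-cong j π ρ eq zero    = refl
    insert-cong j π ρ eq (suc k) = cong (Fin.punchIn j) (eq k)
    image : Fin (suc n) → Perm.Permutation′ n → Perm.Permutation′ (suc n)
    image j π = Perm.insert zero (to σ j) (Perm.remove j σ ↔-∘ π)
    commute : ∀ j π → (σ ↔-∘ Perm.insert zero j π) Perm.≈ image j π
    commute j π zero    = refl
    commute j π (suc k) = Perm.punchIn-permute σ j (to π k)

  -- The tableau R is the row reading.
  tableaux-as-map : ∀ {n} (μ : Partition n) →
                    ∃[ R ] tableaux μ ≡ map (λ π → π ↔-∘ R) (permutations n)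
  tableaux-as-map μ = Perm.cast-id (size μ) ↔-∘ (rowReading (parts μ) ↔-∘
    mk↔ₛ′ (λ (cell i j) → i , j) (λ (i , j) → cell i j) (λ _ → refl) (λ _ → refl)) , refl

  -- Relabelling all tableaux by σ leaves the sum of f unchanged. As bijections carry
  -- proofs, f is required to depend only on the entries of a tableau.
  Σ-tableaux : ∀ {n} {μ : Partition n} (f : Tableau μ → ℕ) →
               (∀ S T → (∀ x → to S x ≡ to T x) → f S ≡ f T) →
               ∀ σ → Σ[ tableaux μ ] (λ T → f (σ ↔-∘ T)) ≡ Σ[ tableaux μ ] f
  Σ-tableaux {n} {μ} f f-cong σ = begin
    Σ[ tableaux μ ] (λ T → f (σ ↔-∘ T))        ≡⟨ unfold (λ T → f (σ ↔-∘ T)) ⟩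
    Σ[ P ] (λ π → f (σ ↔-∘ (π ↔-∘ R)))
      ≡⟨ Σ-cong P (λ π → f-cong (σ ↔-∘ (π ↔-∘ R)) ((σ ↔-∘ π) ↔-∘ R) λ x → refl) ⟩
    Σ[ P ] (λ π → f ((σ ↔-∘ π) ↔-∘ R))
      ≡⟨ Σ-permutations n (λ π → f (π ↔-∘ R)) (λ π ρ eq → f-cong (π ↔-∘ R) (ρ ↔-∘ R) λ x → eq (to R x)) σ ⟩
    Σ[ P ] (λ π → f (π ↔-∘ R))                 ≡⟨ unfold f ⟨
    Σ[ tableaux μ ] f                          ∎
    where
    open ≡-Reasoning
    P = permutations n
    R = proj₁ (tableaux-as-map μ)
    unfold : ∀ h → Σ[ tableaux μ ] h ≡ Σ[ P ] (λ π → h (π ↔-∘ R))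
    unfold h = trans (cong (λ Ts → Σ[ Ts ] h) (proj₂ (tableaux-as-map μ)))
                     (cong sum (sym (map-∘ {g = h} {λ π → π ↔-∘ R} P)))

open Sums

-- The exchange algorithm

module Exchanges {n : ℕ} {μ : Partition n} where

  open import Data.Nat using (_+_)

  infix 4 _≟ᶜ_
  _≟ᶜ_ : (x y : Cell μ) → Dec (x ≡ y)
  cell i j ≟ᶜ cell i′ j′ with i Fin.≟ i′
  ... | no i≢i′ = no λ { refl → i≢i′ refl }
  ... | yes refl with j Fin.≟ j′
  ...   | yes refl = yes refl
  ...   | no j≢j′  = no λ { refl → j≢j′ refl }

  neighbour-≢ : ∀ {x y : Cell μ} → Neighbour x y → x ≢ y
  neighbour-≢ {x} nb refl = ℕ.1+n≢n (sym (neighbour-height {x = x} {x} nb))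

  standard-neighbour : ∀ {T : Tableau μ} → Standard T → ∀ {u v} → Neighbour u v → to T u < to T v
  standard-neighbour std {u} {v} (inj₁ (r , c)) = std u v (inj₂ (sym c , ℕ.≤-reflexive (sym r)))
  standard-neighbour std {u} {v} (inj₂ (r , c)) = std u v (inj₁ (sym r , ℕ.≤-reflexive (sym c)))

  exchange-fst : ∀ (S : Tableau μ) x y → to (exchange x y S) x ≡ to S y
  exchange-fst S x y = transpose-fst (to S x) (to S y)

  exchange-snd : ∀ (S : Tableau μ) {x y} → x ≢ y → to (exchange x y S) y ≡ to S x
  exchange-snd S {x} {y} x≢y =
    transpose-snd (to S x) (to S y) (x≢y ∘ sym ∘ to-injective S)

  exchange-other : ∀ (S : Tableau μ) {x y u} → u ≢ x → u ≢ y → to (exchange x y S) u ≡ to S u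
  exchange-other S u≢x u≢y =
    transpose-other _ _ _ (u≢x ∘ to-injective S) (u≢y ∘ to-injective S)

  -- The next step at S exchanges the entries of x and y: the cell y holds the
  -- smallest entry among the neighbours of x, this entry is smaller than that of x,
  -- and no cell after x is out of order.
  record Next (U S : Tableau μ) (x y : Cell μ) : Set where
    field
      later   : ∀ {u v} → Neighbour u v → to U x < to U u → to S u < to S v
      edge    : Neighbour x y
      minimal : ∀ {v} → Neighbour x v → to S y Fin.≤ to S v
      descent : to S y < to S x

    minimal-< : ∀ {v} → Neighbour x v → v ≢ y → to S y < to S v
    minimal-< nb v≢y = Fin.≤∧≢⇒< (minimal nb) (v≢y ∘ sym ∘ to-injective S)

    edge-≢ : x ≢ y
    edge-≢ = neighbour-≢ {x} {y} edge

  module _ {U S : Tableau μ} where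

    open Next

    greatestBy-≥ : ∀ {A : Set} {m} (f : A → Fin m) {xs y z} → y ∈ xs →
                   greatestBy f xs ≡ just z → f y Fin.≤ f z
    greatestBy-≥ f {x ∷ xs} (here refl) refl = E.f[⊥]≤f[argmax] {f = f} x xs
      where module E = Extrema (Fin.≤-totalOrder _)
    greatestBy-≥ f {x ∷ xs} (there y∈)  refl = All.lookup (E.f[xs]≤f[argmax] {f = f} x xs) y∈
      where module E = Extrema (Fin.≤-totalOrder _)

    nextExchange⇒Next : ∀ {x y} → nextExchange U S ≡ just (x , y) → Next U S x y
    nextExchange⇒Next eq with maxViolation U S in max
    nextExchange⇒Next eq | just x with minNeighbour S x in min
                                     | proj₂ (∈-filter⁻ (violation? S) {xs = cells μ}
                                               (greatestBy-∈ (to U) max))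
    nextExchange⇒Next refl | just x | just y | MaybeAny.just lt = record
      { later   = later′
      ; edge    = proj₂ (∈-filter⁻ (neighbour? x) {xs = cells μ} (leastBy-∈ (to S) min))
      ; minimal = minimal′
      ; descent = lt
      }
      where
      later′ : ∀ {u v} → Neighbour u v → to U x < to U u → to S u < to S v
      later′ {u} {v} nb x<u with Fin.<-cmp (to S u) (to S v)
      ... | tri< u<v _ _ = u<v
      ... | tri≈ _ u≡v _ = contradiction (to-injective S u≡v) (neighbour-≢ {u} {v} nb)
      ... | tri> _ _ v<u with leastBy-≤ (to S) (∈-filter⁺ (neighbour? u) (∈-cells v) nb)
      ...   | z , eq , z≤v = contradiction
              (greatestBy-≥ (to U) (∈-filter⁺ (violation? S) (∈-cells u) violation) max)
              (ℕ.<⇒≱ x<u)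
        where
        violation : Violation S u
        violation = subst (MaybeAny.Any _) (sym eq) (MaybeAny.just (ℕ.≤-<-trans z≤v v<u))
      minimal′ : ∀ {v} → Neighbour x v → to S y Fin.≤ to S v
      minimal′ {v} nb with leastBy-≤ (to S) (∈-filter⁺ (neighbour? x) (∈-cells v) nb)
      ... | z , eq , z≤v with just-injective (trans (sym min) eq)
      ...   | refl = z≤v

    Next-unique : ∀ {x y x′ y′} → Next U S x y → Next U S x′ y′ → x ≡ x′ × y ≡ y′
    Next-unique {x} {y} {x′} {y′} N N′ with Fin.<-cmp (to U x) (to U x′)
    ... | tri< x<x′ _ _ = contradiction (later N (edge N′) x<x′) (ℕ.<⇒≯ (descent N′))
    ... | tri> _ _ x′<x = contradiction (later N′ (edge N) x′<x) (ℕ.<⇒≯ (descent N))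
    ... | tri≈ _ x≡x′ _ with to-injective U x≡x′
    ...   | refl = refl , to-injective S (Fin.≤-antisym (minimal N (edge N′)) (minimal N′ (edge N)))

    Next⇒¬Standard : ∀ {x y} → Next U S x y → ¬ Standard S
    Next⇒¬Standard {x} {y} N std = ℕ.<⇒≯ (descent N) (standard-neighbour {S} std {x} {y} (edge N))

    Next⇒nextExchange : ∀ {x y} → Next U S x y → nextExchange U S ≡ just (x , y)
    Next⇒nextExchange N with nextExchange-just U S (Next⇒¬Standard N)
    ... | x′ , y′ , eq , _ with Next-unique N (nextExchange⇒Next eq)
    ...   | refl , refl = eq

  -- The next step at S exchanges the entry p with a smaller entry a.
  Passes : (U S : Tableau μ) (p a : Fin n) → Set
  Passes U S p a = ∃₂ λ x y → Next U S x y × to S x ≡ p × to S y ≡ a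

  -- Runs of the algorithm

  module Run (U : Tableau μ) (std : Standard U) where

    open Next

    -- The state while an entry travels that started at the cell with U-entry k and has
    -- reached x: the cells with U-entry at least k are in order with their neighbours,
    -- except possibly x, and each of them that has x as a neighbour is also in order with
    -- the neighbours of x.
    record Travelling (k : ℕ) (S : Tableau μ) (x : Cell μ) : Set where
      field
        reached : k ℕ.≤ toℕ (to U x)
        sorted  : ∀ {u v} → Neighbour u v → k ℕ.≤ toℕ (to U u) → u ≢ x → to S u < to S v
        bypass  : ∀ {u v} → Neighbour u x → Neighbour x v → k ℕ.≤ toℕ (to U u) → to S u < to S v

    open Travelling

    private variable
      S : Tableau μ
      T : Tableau μ
      x y x′ y′ : Cell μ
      k m s : ℕ
      p a a′ : Fin n

    increasing : Neighbour x y → to U x < to U y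
    increasing {x} {y} = standard-neighbour {U} std {x} {y}

    -- The cells after the next cell x to be exchanged are in order, so a journey can start
    -- at x; there is nothing to bypass, as the cells adjoining x from above and from the
    -- left come before x.
    start : Next U S x y → Travelling (toℕ (to U x)) S x
    start {x = x} N = record
      { reached = ℕ.≤-refl
      ; sorted  = λ nb le u≢x → later N nb (Fin.≤∧≢⇒< le (u≢x ∘ sym ∘ to-injective U))
      ; bypass  = λ nb _ le → contradiction (increasing nb) (ℕ.≤⇒≯ le)
      }

    -- The neighbour y of x with the smallest entry moves to x, and this entry fits in
    -- there: it is larger than the entries before x by bypass, and smaller than the other
    -- neighbours of x by minimality.
    advance : Travelling k S x → Next U S x y → Travelling k (exchange x y S) y
    advance {k} {S} {x} {y} I N = record
      { reached = k≤y
      ; sorted  = sorted′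
      ; bypass  = bypass′
      }
      where
      S′ = exchange x y S
      at-x : to S′ x ≡ to S y
      at-x = exchange-fst S x y
      at-y : to S′ y ≡ to S x
      at-y = exchange-snd S (edge-≢ N)
      k≤y : k ℕ.≤ toℕ (to U y)
      k≤y = ℕ.≤-trans (reached I) (ℕ.<⇒≤ (increasing (edge N)))
      sorted′ : ∀ {u v} → Neighbour u v → k ℕ.≤ toℕ (to U u) → u ≢ y → to S′ u < to S′ v
      sorted′ {u} {v} nb le u≢y with u ≟ᶜ x | v ≟ᶜ x | v ≟ᶜ y
      ... | yes refl | yes refl | _        = contradiction refl (neighbour-≢ nb)
      ... | yes refl | no  _    | yes refl = subst₂ _<_ (sym at-x) (sym at-y) (descent N)
      ... | yes refl | no  v≢x  | no v≢y   =
        subst₂ _<_ (sym at-x) (sym (exchange-other S v≢x v≢y)) (minimal-< N nb v≢y)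
      ... | no  u≢x  | yes refl | _        =
        subst₂ _<_ (sym (exchange-other S u≢x u≢y)) (sym at-x) (bypass I nb (edge N) le)
      ... | no  u≢x  | no  _    | yes refl =
        subst₂ _<_ (sym (exchange-other S u≢x u≢y)) (sym at-y)
          (Fin.<-trans (sorted I nb le u≢x) (descent N))
      ... | no  u≢x  | no  v≢x  | no  v≢y  =
        subst₂ _<_ (sym (exchange-other S u≢x u≢y)) (sym (exchange-other S v≢x v≢y))
          (sorted I nb le u≢x)
      bypass′ : ∀ {u v} → Neighbour u y → Neighbour y v → k ℕ.≤ toℕ (to U u) → to S′ u < to S′ v
      bypass′ {u} {v} uy yv le =
        subst (to S′ u <_) (sym (exchange-other S v≢x (neighbour-≢ yv ∘ sym))) below
        where
        v≢x : v ≢ x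
        v≢x refl = ℕ.<⇒≯ (increasing (edge N)) (increasing yv)
        y<v : to S y < to S v
        y<v = sorted I yv k≤y (edge-≢ N ∘ sym)
        below : to S′ u < to S v
        below with u ≟ᶜ x
        ... | yes refl = subst (_< to S v) (sym at-x) y<v
        ... | no  u≢x  = subst (_< to S v) (sym (exchange-other S u≢x (neighbour-≢ uy)))
                           (Fin.<-trans (sorted I uy le u≢x) y<v)

    -- After an exchange either the same entry travels on, or a new journey starts at an
    -- earlier cell in the order of U, since the other cells from k on are in order.
    proceed : Travelling k S x → Next U S x y → Next U (exchange x y S) x′ y′ →
              (x′ ≡ y × Travelling k (exchange x y S) x′) ⊎
              (toℕ (to U x′) <ℕ k × Travelling (toℕ (to U x′)) (exchange x y S) x′)
    proceed {k} {S} {x} {y} {x′} {y′} I N N′ with x′ ≟ᶜ y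
    ... | yes refl = inj₁ (refl , advance I N)
    ... | no x′≢y with k ℕ.≤? toℕ (to U x′)
    ...   | yes le = contradiction (sorted (advance I N) (edge N′) le x′≢y) (ℕ.<⇒≯ (descent N′))
    ...   | no ¬le = inj₂ (ℕ.≰⇒> ¬le , start N′)

    -- The entry p lies among the cells from the origin of the current journey on: it
    -- either travels now, and then the entries next to it are at least m, or it has come
    -- to rest. In both cases it will not pass an entry smaller than m from here on.
    record Begun (m : ℕ) (p : Fin n) (S : Tableau μ) (x : Cell μ) : Set where
      field
        {origin}   : ℕ
        travelling : Travelling origin S x
        begun      : ∀ {u} → to S u ≡ p → origin ℕ.≤ toℕ (to U u)
        ahead      : to S x ≡ p → ∀ {v} → Neighbour x v → m ℕ.≤ toℕ (to S v)

    open Begun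

    -- The entries passed by a travelling entry increase, so m grows with each step.
    Begun-step : Begun m p S x → Next U S x y → Next U (exchange x y S) x′ y′ →
                 Begun (suc m) p (exchange x y S) x′
    Begun-step {m} {p} {S} {x} {y} {x′} B N N′ = next (proceed (travelling B) N N′)
      where
      S′ = exchange x y S
      begun′ : ∀ {u} → to S′ u ≡ p → origin B ℕ.≤ toℕ (to U u)
      begun′ {u} at with u ≟ᶜ x | u ≟ᶜ y
      ... | yes refl | _        = reached (travelling B)
      ... | no _     | yes refl = ℕ.≤-trans (reached (travelling B)) (ℕ.<⇒≤ (increasing (edge N)))
      ... | no u≢x   | no u≢y   = begun B (trans (sym (exchange-other S u≢x u≢y)) at)
      ahead′ : to S′ y ≡ p → ∀ {v} → Neighbour y v → suc m ℕ.≤ toℕ (to S′ v)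
      ahead′ at {v} nb = subst (λ e → suc m ℕ.≤ toℕ e) (sym (exchange-other S v≢x v≢y))
        (ℕ.≤-<-trans (ahead B (trans (sym (exchange-snd S (edge-≢ N))) at) (edge N))
                     (sorted (travelling B) nb y≥ (edge-≢ N ∘ sym)))
        where
        v≢x : v ≢ x
        v≢x refl = ℕ.<⇒≯ (increasing (edge N)) (increasing nb)
        v≢y : v ≢ y
        v≢y = neighbour-≢ nb ∘ sym
        y≥ : origin B ℕ.≤ toℕ (to U y)
        y≥ = ℕ.≤-trans (reached (travelling B)) (ℕ.<⇒≤ (increasing (edge N)))
      next : (x′ ≡ y × Travelling (origin B) S′ x′) ⊎
             (toℕ (to U x′) <ℕ origin B × Travelling (toℕ (to U x′)) S′ x′) →
             Begun (suc m) p S′ x′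
      next (inj₁ (refl , I′)) = record { travelling = I′ ; begun = begun′ ; ahead = ahead′ }
      next (inj₂ (x′<k , I′)) = record
        { travelling = I′
        ; begun      = λ at → ℕ.≤-trans (ℕ.<⇒≤ x′<k) (begun′ at)
        ; ahead      = λ at → contradiction (begun′ at) (ℕ.<⇒≱ x′<k)
        }

    steps-suc : Next U (steps U T s) x y → steps U T (suc s) ≡ exchange x y (steps U T s)
    steps-suc N rewrite Next⇒nextExchange N = refl

    Next-suc : Next U (steps U T s) x y → Next U (steps U T (suc s)) x′ y′ →
               Next U (exchange x y (steps U T s)) x′ y′
    Next-suc {T = T} {s} N = subst (λ S → Next U S _ _) (steps-suc {T = T} {s} N)

    -- Without a next exchange at time s the state at time s + 1 is the same, so there is
    -- none at time s + 1 either.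
    Next-pred : Next U (steps U T (suc s)) x′ y′ → ∃₂ λ x y → Next U (steps U T s) x y
    Next-pred {T} {s} N′ with nextExchange U (steps U T s) in eq
    ... | just (x , y) = x , y , nextExchange⇒Next eq
    ... | nothing with trans (sym eq) (Next⇒nextExchange N′)
    ...   | ()

    Next-earlier : ∀ d → Next U (steps U T (d + s)) x′ y′ → ∃₂ λ x y → Next U (steps U T s) x y
    Next-earlier ℕ.zero  N′ = _ , _ , N′
    Next-earlier {T} {s} (suc d) N′ =
      Next-earlier {T} {s} d (proj₂ (proj₂ (Next-pred {T} {d + s} N′)))

    travelling-at : ∀ s → Next U (steps U T s) x y → ∃[ k ] Travelling k (steps U T s) x
    travelling-at ℕ.zero N = _ , start N
    travelling-at {T} {x} (suc s) N′ with Next-pred {T} {s} N′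
    ... | x₀ , y₀ , N with proceed (proj₂ (travelling-at {T} s N)) N (Next-suc {T} {s} N N′)
    ...   | inj₁ (_ , I) = subst (λ S → ∃[ k ] Travelling k S x) (sym (steps-suc {T} {s} N)) (_ , I)
    ...   | inj₂ (_ , I) = subst (λ S → ∃[ k ] Travelling k S x) (sym (steps-suc {T} {s} N)) (_ , I)

    Begun-later : ∀ d → Next U (steps U T s) x y → Begun m p (steps U T s) x →
                  Next U (steps U T (d + s)) x′ y′ → Begun (d + m) p (steps U T (d + s)) x′
    Begun-later ℕ.zero N B N′ with Next-unique N N′
    ... | refl , refl = B
    Begun-later {T} {s} {x′ = x′} (suc d) N B N′ with Next-pred {T} {d + s} N′
    ... | x₁ , y₁ , N₁ = subst (λ S → Begun _ _ S x′) (sym (steps-suc {T} {d + s} N₁))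
      (Begun-step (Begun-later {T} {s} d N B N₁) N₁ (Next-suc {T} {d + s} N₁ N′))

    -- The second passing takes place at least one step after the first.
    passes-increase : ∀ d → Passes U (steps U T s) p a →
                      Passes U (steps U T (suc d + s)) p a′ → a < a′
    passes-increase {T} {s} {p} {a} d (x , y , N , at-x , at-y) (x′ , y′ , N′ , at-x′ , at-y′) =
      ℕ.≤-trans (ℕ.s≤s (ℕ.m≤n+m (toℕ a) d))
        (subst (λ e → suc d + toℕ a ℕ.≤ toℕ e) at-y′
          (ahead (Begun-later {T} {s} (suc d) N B N′) at-x′ (edge N′)))
      where
      I = proj₂ (travelling-at {T} s N)
      B : Begun (toℕ a) p (steps U T s) x
      B = record
        { travelling = I
        ; begun = λ at → subst (λ u → _ ℕ.≤ toℕ (to U u))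
                               (sym (to-injective (steps U T s) (trans at (sym at-x)))) (reached I)
        ; ahead = λ _ nb → subst (λ e → toℕ e ℕ.≤ _) at-y (minimal N nb)
        }

    -- An entry lying beyond the current cell in the order of U has come to rest. The bound
    -- m = n in Begun excludes all further exchanges with smaller entries.
    at-rest : ∀ d → Next U (steps U T s) x y → ∀ {u} → to U x < to U u →
              to (steps U T s) u ≡ p → ¬ Passes U (steps U T (d + s)) p a
    at-rest {T} {s} {x} {p = p} d N {u} x<u at (x′ , y′ , N′ , at-x′ , _) =
      ℕ.<⇒≱ (Fin.toℕ<n (to (steps U T (d + s)) y′))
        (ℕ.≤-trans (ℕ.m≤n+m n d) (ahead (Begun-later {T} {s} d N B N′) at-x′ (edge N′)))
      where
      I = proj₂ (travelling-at {T} s N)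
      here-only : ∀ {w} → to (steps U T s) w ≡ p → u ≡ w
      here-only at′ = to-injective (steps U T s) (trans at (sym at′))
      B : Begun n p (steps U T s) x
      B = record
        { travelling = I
        ; begun = λ at′ → subst (λ w → _ ℕ.≤ toℕ (to U w)) (here-only at′)
                                (ℕ.≤-trans (reached I) (ℕ.<⇒≤ x<u))
        ; ahead = λ at′ → contradiction (cong (toℕ ∘ to U) (sym (here-only at′))) (ℕ.<⇒≢ x<u)
        }

    -- A relabelling σ of the entries which takes p to q and preserves c < d whenever c is
    -- not p and (c , d) is not (q , p). The identity (with p = q) and the transposition
    -- of two consecutive entries p and q are of this kind.
    module Relabelling {p q : Fin n} (σ : Fin n → Fin n) (σp≡q : σ p ≡ q)
      (σ-mono : ∀ {c d} → c ≢ p → ¬ (c ≡ q × d ≡ p) → c < d → σ c < σ d) where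

      -- T′ is T with its entries relabelled by σ.
      _∼_ : Tableau μ → Tableau μ → Set
      T ∼ T′ = ∀ x → to T′ x ≡ σ (to T x)

      exchange-∼ : ∀ {S S′} → x ≢ y → S ∼ S′ → exchange x y S ∼ exchange x y S′
      exchange-∼ {x} {y} {S} {S′} x≢y S∼S′ u with u ≟ᶜ x | u ≟ᶜ y
      ... | yes refl | _        = trans (exchange-fst S′ x y)
                                    (trans (S∼S′ y) (cong σ (sym (exchange-fst S x y))))
      ... | no _     | yes refl = trans (exchange-snd S′ x≢y)
                                    (trans (S∼S′ x) (cong σ (sym (exchange-snd S x≢y))))
      ... | no u≢x   | no u≢y   = trans (exchange-other S′ u≢x u≢y)
                                    (trans (S∼S′ u) (cong σ (sym (exchange-other S u≢x u≢y))))

      -- The next exchange is the same for S and S′ if p is neither beyond the current cell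
      -- nor about to pass q.
      Next-∼ : ∀ {S S′} → S ∼ S′ → Next U S x y → (∀ {u} → to U x < to U u → to S u ≢ p) →
               ¬ (to S y ≡ q × to S x ≡ p) → Next U S′ x y
      Next-∼ {x} {y} {S} {S′} S∼S′ N ≢p ¬qp = record
        { later   = λ nb x<u → transport (later N nb x<u) (≢p x<u)
                      λ (_ , v≡p) → ≢p (Fin.<-trans x<u (increasing nb)) v≡p
        ; edge    = edge N
        ; minimal = minimal′
        ; descent = transport (descent N) (≢p (increasing (edge N))) ¬qp
        }
        where
        transport : ∀ {u v} → to S u < to S v → to S u ≢ p → ¬ (to S u ≡ q × to S v ≡ p) →
                    to S′ u < to S′ v
        transport {u} {v} lt u≢p ¬qp′ =
          subst₂ _<_ (sym (S∼S′ u)) (sym (S∼S′ v)) (σ-mono u≢p ¬qp′ lt)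
        minimal′ : ∀ {v} → Neighbour x v → to S′ y Fin.≤ to S′ v
        minimal′ {v} nb with v ≟ᶜ y
        ... | yes refl = ℕ.≤-refl
        ... | no v≢y   = ℕ.<⇒≤ (transport (minimal-< N nb v≢y) (≢p (increasing (edge N)))
                                  λ (_ , v≡p) → ≢p (increasing nb) v≡p)

      -- Up to the step at which p passes a, the runs from T and T′ agree up to
      -- relabelling. Whatever σ could disturb would put p beyond the current cell, where it
      -- is at rest, or make p pass q, after which it only passes entries larger than q;
      -- neither is possible before p passes a < q.
      Passes-∼ : ∀ {T T′} → T ∼ T′ → a < q → σ a ≡ a → ∀ s →
                 Passes U (steps U T s) p a → Passes U (steps U T′ s) q a
      Passes-∼ {a} {T} {T′} T∼T′ a<q σa≡a s P@(x , y , N , at-x , at-y) =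
        x , y , Next-∼ (agree s 0 refl) N resting ¬qp ,
        trans (agree s 0 refl x) (trans (cong σ at-x) σp≡q) ,
        trans (agree s 0 refl y) (trans (cong σ at-y) σa≡a)
        where
        resting : ∀ {u} → to U x < to U u → to (steps U T s) u ≢ p
        resting x<u at = at-rest {T} {s} 0 N x<u at P
        ¬qp : ¬ (to (steps U T s) y ≡ q × to (steps U T s) x ≡ p)
        ¬qp (y≡q , _) = Fin.<-irrefl (trans (sym at-y) y≡q) a<q
        agree : ∀ t d → d + t ≡ s → steps U T t ∼ steps U T′ t
        agree ℕ.zero  d eq   = T∼T′
        agree (suc t) d refl = subst₂ _∼_ (sym (steps-suc {T} {t} Nₜ)) (sym (steps-suc {T′} {t} Nₜ′))
                                 (exchange-∼ {S = steps U T t} {steps U T′ t} (edge-≢ Nₜ) ∼ₜ)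
          where
          eq : suc d + t ≡ d + suc t
          eq = sym (ℕ.+-suc d t)
          Pₛ : Passes U (steps U T (suc d + t)) p a
          Pₛ = subst (λ r → Passes U (steps U T r) p a) (sym eq) P
          ∼ₜ : steps U T t ∼ steps U T′ t
          ∼ₜ = agree t (suc d) eq
          before : ∃₂ λ xₜ yₜ → Next U (steps U T t) xₜ yₜ
          before = Next-earlier {T} {t} (suc d) (proj₁ (proj₂ (proj₂ Pₛ)))
          Nₜ = proj₂ (proj₂ before)
          Nₜ′ = Next-∼ ∼ₜ Nₜ
            (λ x<u at → at-rest {T} {t} (suc d) Nₜ x<u at Pₛ)
            (λ (y≡q , x≡p) → ℕ.<⇒≯ a<q
              (passes-increase {T} {t} d (_ , _ , Nₜ , x≡p , y≡q) Pₛ))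

    -- Exchanges of a given pair

    exchangedAt? : ∀ (T : Tableau μ) a b s → Dec (ExchangedAt U T a b s)
    exchangedAt? T a b s =
      MaybeAny.dec (swapped? (steps U T s) a b) (nextExchange U (steps U T s))

    exchangedAt⇒passes : ∀ {a b} → a < b → ExchangedAt U T a b s → Passes U (steps U T s) b a
    exchangedAt⇒passes {T} {s} a<b ex with nextExchange U (steps U T s) in eq
    exchangedAt⇒passes a<b (MaybeAny.just (inj₂ (at-x , at-y))) | just (x , y) =
      x , y , nextExchange⇒Next eq , at-x , at-y
    exchangedAt⇒passes {T} {s} a<b (MaybeAny.just (inj₁ (refl , refl))) | just (x , y) =
      contradiction (descent {U} {steps U T s} {x} {y} (nextExchange⇒Next eq)) (ℕ.<⇒≯ a<b)

    passes⇒exchangedAt : ∀ {a b} → Passes U (steps U T s) b a → ExchangedAt U T a b s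
    passes⇒exchangedAt (x , y , N , at-x , at-y) rewrite Next⇒nextExchange N =
      MaybeAny.just (inj₂ (at-x , at-y))

    Next⇒<stoppingTime : Next U (steps U T s) x y → s <ℕ stoppingTime U T
    Next⇒<stoppingTime {T} {s} N with s ℕ.<? stoppingTime U T
    ... | yes s<r = s<r
    ... | no ¬s<r = contradiction (proj₁ (proj₂ (firstStandard U T)))
      (Next⇒¬Standard (proj₂ (proj₂ (Next-earlier {T} (s ∸ r)
        (subst (λ t → Next U (steps U T t) _ _) (sym (ℕ.m∸n+n≡m (ℕ.≮⇒≥ ¬s<r))) N)))))
      where r = stoppingTime U T

    Exchanged⇒passes : ∀ {a b} → a < b → Exchanged U a b T → ∃[ s ] Passes U (steps U T s) b a
    Exchanged⇒passes {T} a<b (s , _ , ex) = s , exchangedAt⇒passes {T} {s} a<b ex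

    passes⇒Exchanged : ∀ {a b} s → Passes U (steps U T s) b a → Exchanged U a b T
    passes⇒Exchanged {T} s P@(_ , _ , N , _) =
      s , Next⇒<stoppingTime {T} {s} N , passes⇒exchangedAt {T} {s} P

    gap : ∀ {s t} → s <ℕ t → suc (t ∸ suc s) + s ≡ t
    gap s<t = trans (sym (ℕ.+-suc _ _)) (ℕ.m∸n+n≡m s<t)

    passes-once : ∀ {s t a b} → Passes U (steps U T s) b a → Passes U (steps U T t) b a → s ≡ t
    passes-once {T} {s} {t} {a} {b} P Q with ℕ.<-cmp s t
    ... | tri≈ _ s≡t _ = s≡t
    ... | tri< s<t _ _ = contradiction (passes-increase {T} {s} (t ∸ suc s) P
            (subst (λ r → Passes U (steps U T r) b a) (sym (gap s<t)) Q)) (Fin.<-irrefl refl)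
    ... | tri> _ _ t<s = contradiction (passes-increase {T} {t} (s ∸ suc t) Q
            (subst (λ r → Passes U (steps U T r) b a) (sym (gap t<s)) P)) (Fin.<-irrefl refl)

    -- Independence of the exchange numbers of the larger entry

    Exchanged-∼ : ∀ {p q} (σ : Fin n → Fin n) → σ p ≡ q →
                  (∀ {c d} → c ≢ p → ¬ (c ≡ q × d ≡ p) → c < d → σ c < σ d) →
                  ∀ {a} → a < p → a < q → σ a ≡ a →
                  ∀ {T T′} → (∀ x → to T′ x ≡ σ (to T x)) → Exchanged U a p T → Exchanged U a q T′
    Exchanged-∼ σ σp≡q σ-mono a<p a<q σa≡a {T} {T′} T∼T′ ex with Exchanged⇒passes {T} a<p ex
    ... | s , P = passes⇒Exchanged {T′} s (Passes-∼ {T = T} {T′} T∼T′ a<q σa≡a s P)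
      where open Relabelling σ σp≡q σ-mono

    -- Being exchanged does not depend on the tableau beyond its values; this is the
    -- relabelling by the identity.
    Exchanged-cong : ∀ {a p} → a < p → ∀ {T T′} → (∀ x → to T′ x ≡ to T x) →
                     Exchanged U a p T → Exchanged U a p T′
    Exchanged-cong a<p {T} {T′} = Exchanged-∼ id refl (λ _ _ c<d → c<d) a<p a<p refl {T} {T′}

    -- The values p and q differ by one, in either direction.
    Consecutive : Fin n → Fin n → Set
    Consecutive p q = toℕ q ≡ suc (toℕ p) ⊎ toℕ p ≡ suc (toℕ q)

    transpose-mono : ∀ {p q} → Consecutive p q → ∀ {c d} → c ≢ p → ¬ (c ≡ q × d ≡ p) → c < d →
                     PC.transpose p q c < PC.transpose p q d
    transpose-mono {p} {q} adj {c} {d} c≢p ¬qp c<d = cases (c Fin.≟ q) (d Fin.≟ p) (d Fin.≟ q)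
      where
      above-q : Consecutive p q → q < d → d ≢ p → p < d
      above-q (inj₁ eq) q<d d≢p = ℕ.<-trans (ℕ.≤-reflexive (sym eq)) q<d
      above-q (inj₂ eq) q<d d≢p = Fin.≤∧≢⇒< (subst (ℕ._≤ toℕ d) (sym eq) q<d) (d≢p ∘ sym)
      below : ∀ {r t} → Consecutive r t → c < r → c ≢ t → c < t
      below (inj₁ eq) c<r c≢t = ℕ.<-trans c<r (ℕ.≤-reflexive (sym eq))
      below (inj₂ eq) c<r c≢t = Fin.≤∧≢⇒< (ℕ.≤-pred (subst (suc (toℕ c) ℕ.≤_) eq c<r)) c≢t
      cases : Dec (c ≡ q) → Dec (d ≡ p) → Dec (d ≡ q) → PC.transpose p q c < PC.transpose p q d
      cases (yes refl) (yes refl) _          = contradiction (refl , refl) ¬qp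
      cases (yes refl) (no _)     (yes refl) = contradiction c<d (Fin.<-irrefl refl)
      cases (yes refl) (no d≢p)   (no d≢q)   = subst₂ _<_ (sym (transpose-snd p q c≢p))
        (sym (transpose-other p q d d≢p d≢q)) (above-q adj c<d d≢p)
      cases (no c≢q)   (yes refl) _          = subst₂ _<_ (sym (transpose-other p q c c≢p c≢q))
        (sym (transpose-fst p q)) (below adj c<d c≢q)
      cases (no c≢q)   (no d≢p)   (yes refl) = subst₂ _<_ (sym (transpose-other p q c c≢p c≢q))
        (sym (transpose-snd p q d≢p)) (below (swap adj) c<d c≢p)
      cases (no c≢q)   (no d≢p)   (no d≢q)   = subst₂ _<_ (sym (transpose-other p q c c≢p c≢q))
        (sym (transpose-other p q d d≢p d≢q)) c<d

    Exchanged-transpose : ∀ {a p q} → a < p → a < q → Consecutive p q →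
                          ∀ {T T′} → (∀ x → to T′ x ≡ PC.transpose p q (to T x)) →
                          Exchanged U a p T → Exchanged U a q T′
    Exchanged-transpose {a} {p} {q} a<p a<q adj {T} {T′} =
      Exchanged-∼ (PC.transpose p q) (transpose-fst p q) (transpose-mono adj) a<p a<q
        (transpose-other p q a (Fin.<⇒≢ a<p) (Fin.<⇒≢ a<q)) {T} {T′}

    exchangeNumber-Σ : ∀ a b → exchangeNumber U a b ≡ Σ[ tableaux μ ] (λ T → ⟦ exchanged? U a b T ⟧)
    exchangeNumber-Σ a b = length-filter (exchanged? U a b) (tableaux μ)

    exchangeNumber-consecutive : ∀ {a p q} → a < p → a < q → Consecutive p q →
                                 exchangeNumber U a p ≡ exchangeNumber U a q
    exchangeNumber-consecutive {a} {p} {q} a<p a<q adj = begin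
      exchangeNumber U a p                                    ≡⟨ exchangeNumber-Σ a p ⟩
      Σ[ tableaux μ ] (λ T → ⟦ exchanged? U a p T ⟧)
        ≡⟨ Σ-cong (tableaux μ) (λ T → ⟦⟧-cong (exchanged? U a p T) (exchanged? U a q (σ ↔-∘ T))
             (Exchanged-transpose a<p a<q adj {T} {σ ↔-∘ T} (λ x → refl))
             (Exchanged-transpose a<q a<p (swap adj) {σ ↔-∘ T} {T}
               (λ x → sym (PC.transpose-inverse q p)))) ⟩
      Σ[ tableaux μ ] (λ T → ⟦ exchanged? U a q (σ ↔-∘ T) ⟧)
        ≡⟨ Σ-tableaux (λ T → ⟦ exchanged? U a q T ⟧) (λ S T S≗T →
             ⟦⟧-cong (exchanged? U a q S) (exchanged? U a q T)
               (Exchanged-cong a<q {S} {T} (sym ∘ S≗T)) (Exchanged-cong a<q {T} {S} S≗T)) σ ⟩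
      Σ[ tableaux μ ] (λ T → ⟦ exchanged? U a q T ⟧)          ≡⟨ exchangeNumber-Σ a q ⟨
      exchangeNumber U a q                                    ∎
      where
      open ≡-Reasoning
      σ = Perm.transpose p q

    exchangeNumber-climb : ∀ d {a p q} → a < p → a < q → toℕ q ≡ d + toℕ p →
                           exchangeNumber U a p ≡ exchangeNumber U a q
    exchangeNumber-climb ℕ.zero  {a} a<p a<q eq =
      cong (exchangeNumber U a) (sym (Fin.toℕ-injective eq))
    exchangeNumber-climb (suc d) {a} {p} {q} a<p a<q eq =
      trans (exchangeNumber-climb d a<p a<r toℕ-r)
            (exchangeNumber-consecutive a<r a<q (inj₁ (trans eq (cong suc (sym toℕ-r)))))
      where
      r<n : d + toℕ p <ℕ n
      r<n = ℕ.<-trans (ℕ.≤-reflexive (sym eq)) (Fin.toℕ<n q)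
      r = Fin.fromℕ< r<n
      toℕ-r : toℕ r ≡ d + toℕ p
      toℕ-r = Fin.toℕ-fromℕ< r<n
      a<r : a < r
      a<r = subst (toℕ a <ℕ_) (sym toℕ-r) (ℕ.≤-trans a<p (ℕ.m≤n+m (toℕ p) d))

    exchangeNumber-independent : ∀ {a p q} → a < p → a < q →
                                 exchangeNumber U a p ≡ exchangeNumber U a q
    exchangeNumber-independent {a} {p} {q} a<p a<q with ℕ.≤-total (toℕ p) (toℕ q)
    ... | inj₁ p≤q = exchangeNumber-climb (toℕ q ∸ toℕ p) a<p a<q (sym (ℕ.m∸n+n≡m p≤q))
    ... | inj₂ q≤p = sym (exchangeNumber-climb (toℕ p ∸ toℕ q) a<q a<p (sym (ℕ.m∸n+n≡m q≤p)))

    -- Balance of heights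

    entryHeight-at : ∀ (S : Tableau μ) {u e} → to S u ≡ e → entryHeight e S ≡ height u
    entryHeight-at S {u} refl = cong height (strictlyInverseʳ S u)

    -- The amounts (0 or 1) by which the exchange at time s decreases the height of b, when
    -- b is the smaller of the two entries, and increases it, when b is the larger one.
    up down : Tableau μ → Fin n → ℕ → ℕ
    up   T b s = ∑ {n} λ c → ⟦ (b <? c) ×-dec exchangedAt? T b c s ⟧
    down T b s = ∑ {n} λ a → ⟦ (a <? b) ×-dec exchangedAt? T a b s ⟧

    balance-step : ∀ T b s → Next U (steps U T s) x y →
                   entryHeight b (steps U T (suc s)) + up T b s ≡
                   entryHeight b (steps U T s) + down T b s
    balance-step {x} {y} T b s N =
      trans (cong (λ V → entryHeight b V + up T b s) (steps-suc {T} {s} N))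
            (cases (b Fin.≟ to Tₛ x) (b Fin.≟ to Tₛ y))
      where
      Tₛ = steps U T s
      Tₛ′ = exchange x y Tₛ
      hy : height y ≡ suc (height x)
      hy = neighbour-height {x = x} {y} (edge N)
      passed : ∀ {p a} → Passes U Tₛ p a → p ≡ to Tₛ x × a ≡ to Tₛ y
      passed (x′ , y′ , N′ , refl , refl) with Next-unique N′ N
      ... | refl , refl = refl , refl
      pass : Passes U Tₛ (to Tₛ x) (to Tₛ y)
      pass = x , y , N , refl , refl
      exchanged : ∀ {p a} → (a < p × ExchangedAt U T a p s) → p ≡ to Tₛ x × a ≡ to Tₛ y
      exchanged (a<p , ex) = passed (exchangedAt⇒passes {T} {s} a<p ex)
      up-0 : b ≢ to Tₛ y → up T b s ≡ 0
      up-0 b≢y = ∑-zero {n} _ λ c →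
        ⟦⟧-no ((b <? c) ×-dec exchangedAt? T b c s) (b≢y ∘ proj₂ ∘ exchanged)
      down-0 : b ≢ to Tₛ x → down T b s ≡ 0
      down-0 b≢x = ∑-zero {n} _ λ a →
        ⟦⟧-no ((a <? b) ×-dec exchangedAt? T a b s) (b≢x ∘ proj₁ ∘ exchanged)
      up-1 : b ≡ to Tₛ y → up T b s ≡ 1
      up-1 refl = trans
        (∑-single {n} (λ c → ⟦ (b <? c) ×-dec exchangedAt? T b c s ⟧) (to Tₛ x) λ c c≢x →
          ⟦⟧-no ((b <? c) ×-dec exchangedAt? T b c s) (c≢x ∘ proj₁ ∘ exchanged))
        (⟦⟧-yes ((b <? to Tₛ x) ×-dec exchangedAt? T b (to Tₛ x) s)
          (descent N , passes⇒exchangedAt {T} {s} pass))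
      down-1 : b ≡ to Tₛ x → down T b s ≡ 1
      down-1 refl = trans
        (∑-single {n} (λ a → ⟦ (a <? b) ×-dec exchangedAt? T a b s ⟧) (to Tₛ y) λ a a≢y →
          ⟦⟧-no ((a <? b) ×-dec exchangedAt? T a b s) (a≢y ∘ proj₂ ∘ exchanged))
        (⟦⟧-yes ((to Tₛ y <? b) ×-dec exchangedAt? T (to Tₛ y) b s)
          (descent N , passes⇒exchangedAt {T} {s} pass))
      x≢y : to Tₛ x ≢ to Tₛ y
      x≢y = edge-≢ N ∘ to-injective Tₛ
      open ≡-Reasoning
      cases : Dec (b ≡ to Tₛ x) → Dec (b ≡ to Tₛ y) →
              entryHeight b Tₛ′ + up T b s ≡ entryHeight b Tₛ + down T b s
      cases (yes b≡x) _ = begin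
        entryHeight b Tₛ′ + up T b s
          ≡⟨ cong₂ _+_ (entryHeight-at Tₛ′ (trans (exchange-snd Tₛ (edge-≢ N)) (sym b≡x)))
                         (up-0 λ b≡y → x≢y (trans (sym b≡x) b≡y)) ⟩
        height y + 0                     ≡⟨ ℕ.+-identityʳ _ ⟩
        height y                         ≡⟨ trans hy (ℕ.+-comm 1 _) ⟩
        height x + 1
          ≡⟨ cong₂ _+_ (entryHeight-at Tₛ (sym b≡x)) (down-1 b≡x) ⟨
        entryHeight b Tₛ + down T b s   ∎
      cases (no b≢x) (yes b≡y) = begin
        entryHeight b Tₛ′ + up T b s
          ≡⟨ cong₂ _+_ (entryHeight-at Tₛ′ (trans (exchange-fst Tₛ x y) (sym b≡y))) (up-1 b≡y) ⟩
        height x + 1                     ≡⟨ trans (ℕ.+-comm _ 1) (sym hy) ⟩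
        height y                         ≡⟨ ℕ.+-identityʳ _ ⟨
        height y + 0
          ≡⟨ cong₂ _+_ (entryHeight-at Tₛ (sym b≡y)) (down-0 b≢x) ⟨
        entryHeight b Tₛ + down T b s   ∎
      cases (no b≢x) (no b≢y) = cong₂ _+_
        (entryHeight-at Tₛ′ (trans (exchange-other Tₛ (b≢x ∘ at) (b≢y ∘ at)) (strictlyInverseˡ Tₛ b)))
        (trans (up-0 b≢y) (sym (down-0 b≢x)))
        where
        at : ∀ {u} → from Tₛ b ≡ u → b ≡ to Tₛ u
        at refl = sym (strictlyInverseˡ Tₛ b)

    -- The left-hand side counts the times at which a and b are exchanged.
    ∑-exchangedAt : ∀ T a b →
      ∑ {stoppingTime U T} (λ s → ⟦ (a <? b) ×-dec exchangedAt? T a b (toℕ s) ⟧) ≡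
      ⟦ a <? b ⟧ * ⟦ exchanged? U a b T ⟧
    ∑-exchangedAt T a b =
      trans (count ((a <? b) ×-dec exchanged? U a b T)) (⟦⟧-× (a <? b) (exchanged? U a b T))
      where
      r = stoppingTime U T
      at? : ∀ s → Dec (a < b × ExchangedAt U T a b s)
      at? s = (a <? b) ×-dec exchangedAt? T a b s
      count : (e? : Dec (a < b × Exchanged U a b T)) → ∑ {r} (λ s → ⟦ at? (toℕ s) ⟧) ≡ ⟦ e? ⟧
      count (no ¬e) = ∑-zero {r} _ λ s → ⟦⟧-no (at? (toℕ s))
        λ (a<b , ex) → ¬e (a<b , toℕ s , Fin.toℕ<n s , ex)
      count (yes (a<b , t , t<r , ex)) = trans
        (∑-single {r} (λ s → ⟦ at? (toℕ s) ⟧) t′ λ s s≢t → ⟦⟧-no (at? (toℕ s))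
          λ (_ , ex′) → s≢t (Fin.toℕ-injective (passes-once {T} {toℕ s} {toℕ t′}
            (exchangedAt⇒passes {T} {toℕ s} a<b ex′) (exchangedAt⇒passes {T} {toℕ t′} a<b ex″))))
        (⟦⟧-yes (at? (toℕ t′)) (a<b , ex″))
        where
        t′ : Fin r
        t′ = Fin.fromℕ< t<r
        ex″ : ExchangedAt U T a b (toℕ t′)
        ex″ = subst (ExchangedAt U T a b) (sym (Fin.toℕ-fromℕ< t<r)) ex

    balance : ∀ T b →
      entryHeight b (φ U T) + ∑ {n} (λ c → ⟦ b <? c ⟧ * ⟦ exchanged? U b c T ⟧) ≡
      entryHeight b T + ∑ {n} (λ a → ⟦ a <? b ⟧ * ⟦ exchanged? U a b T ⟧)
    balance T b = begin
      entryHeight b (φ U T) + ∑ {n} (λ c → ⟦ b <? c ⟧ * ⟦ exchanged? U b c T ⟧)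
        ≡⟨ cong (entryHeight b (φ U T) +_) (collect (λ c → b , c)) ⟨
      entryHeight b (φ U T) + ∑ {r} (up T b ∘ toℕ)
        ≡⟨ telescope (λ s → entryHeight b (steps U T s)) (up T b) (down T b) r step ⟩
      entryHeight b T + ∑ {r} (down T b ∘ toℕ)
        ≡⟨ cong (entryHeight b T +_) (collect (λ a → a , b)) ⟩
      entryHeight b T + ∑ {n} (λ a → ⟦ a <? b ⟧ * ⟦ exchanged? U a b T ⟧) ∎
      where
      open ≡-Reasoning
      r = stoppingTime U T
      step : ∀ s → s <ℕ r → entryHeight b (steps U T (suc s)) + up T b s ≡
                            entryHeight b (steps U T s) + down T b s
      step s s<r with nextExchange-just U (steps U T s) (proj₂ (proj₂ (firstStandard U T)) s s<r)
      ... | x , y , eq , _ = balance-step T b s (nextExchange⇒Next eq)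
      collect : (ac : Fin n → Fin n × Fin n) →
        ∑ {r} (λ s → ∑ {n} λ i → ⟦ (proj₁ (ac i) <? proj₂ (ac i)) ×-dec
                                    exchangedAt? T (proj₁ (ac i)) (proj₂ (ac i)) (toℕ s) ⟧) ≡
        ∑ {n} (λ i → ⟦ proj₁ (ac i) <? proj₂ (ac i) ⟧ *
                     ⟦ exchanged? U (proj₁ (ac i)) (proj₂ (ac i)) T ⟧)
      collect ac = trans (∑-comm {r} {n} _)
        (sum-cong-≗ {n} λ i → ∑-exchangedAt T (proj₁ (ac i)) (proj₂ (ac i)))

    total-balance : ∀ b →
      terminalHeight U b + ∑ {n} (λ c → ⟦ b <? c ⟧ * exchangeNumber U b c) ≡
      initialHeight μ b + ∑ {n} (λ a → ⟦ a <? b ⟧ * exchangeNumber U a b)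
    total-balance b = begin
      terminalHeight U b + ∑ {n} (λ c → ⟦ b <? c ⟧ * exchangeNumber U b c)
        ≡⟨ cong (terminalHeight U b +_) (collect (λ c → b , c)) ⟩
      terminalHeight U b + Σ[ tableaux μ ] (λ T → ∑ {n} (λ c → ⟦ b <? c ⟧ * ⟦ exchanged? U b c T ⟧))
        ≡⟨ Σ-+ (tableaux μ) _ _ ⟨
      Σ[ tableaux μ ] (λ T → entryHeight b (φ U T) +
                             ∑ {n} (λ c → ⟦ b <? c ⟧ * ⟦ exchanged? U b c T ⟧))
        ≡⟨ Σ-cong (tableaux μ) (λ T → balance T b) ⟩
      Σ[ tableaux μ ] (λ T → entryHeight b T +
                             ∑ {n} (λ a → ⟦ a <? b ⟧ * ⟦ exchanged? U a b T ⟧))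
        ≡⟨ Σ-+ (tableaux μ) _ _ ⟩
      initialHeight μ b + Σ[ tableaux μ ] (λ T → ∑ {n} (λ a → ⟦ a <? b ⟧ * ⟦ exchanged? U a b T ⟧))
        ≡⟨ cong (initialHeight μ b +_) (collect (λ a → a , b)) ⟨
      initialHeight μ b + ∑ {n} (λ a → ⟦ a <? b ⟧ * exchangeNumber U a b) ∎
      where
      open ≡-Reasoning
      collect : (ac : Fin n → Fin n × Fin n) →
        ∑ {n} (λ i → ⟦ proj₁ (ac i) <? proj₂ (ac i) ⟧ *
                     exchangeNumber U (proj₁ (ac i)) (proj₂ (ac i))) ≡
        Σ[ tableaux μ ] (λ T → ∑ {n} (λ i → ⟦ proj₁ (ac i) <? proj₂ (ac i) ⟧ *
                                          ⟦ exchanged? U (proj₁ (ac i)) (proj₂ (ac i)) T ⟧))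
      collect ac = trans
        (sum-cong-≗ {n} λ i →
          trans (cong (⟦ proj₁ (ac i) <? proj₂ (ac i) ⟧ *_)
                      (exchangeNumber-Σ (proj₁ (ac i)) (proj₂ (ac i))))
                (sym (Σ-* (tableaux μ) ⟦ proj₁ (ac i) <? proj₂ (ac i) ⟧ _)))
        (sym (Σ-∑-comm {n = n} (tableaux μ) _))

  -- The inverse of the transposition of c and b takes b to c.
  initialHeight-independent : ∀ b c → initialHeight μ b ≡ initialHeight μ c
  initialHeight-independent b c = sym (trans
    (Σ-cong (tableaux μ) λ T → cong (height ∘ from T) (sym (transpose-fst b c)))
    (Σ-tableaux (entryHeight b) from-cong (Perm.transpose c b)))
    where
    from-cong : ∀ (S T : Tableau μ) → (∀ x → to S x ≡ to T x) → entryHeight b S ≡ entryHeight b T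
    from-cong S T S≗T = cong height (to-injective S
      (trans (strictlyInverseˡ S b) (sym (trans (S≗T _) (strictlyInverseˡ T b)))))

  height-recursion : ∀ (U : Tableau μ) → Standard U →
    (β : Fin n → Fin n) → (∀ a → suc (toℕ a) <ℕ n → a < β a) → ∀ c b →
    terminalHeight U b + (n ∸ suc (toℕ b)) * exchangeNumber U b (β b) ≡
    initialHeight μ c + sum (map (λ a → exchangeNumber U a (β a)) (filter (_<? b) (allFin n)))
  height-recursion U std β β> c b = begin
    terminalHeight U b + (n ∸ suc (toℕ b)) * exchangeNumber U b (β b)
      ≡⟨ cong (terminalHeight U b +_) (∑-above b (exchangeNumber U b (β b))) ⟨
    terminalHeight U b + ∑ {n} (λ d → ⟦ b <? d ⟧ * exchangeNumber U b (β b))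
      ≡⟨ cong (terminalHeight U b +_) (sum-cong-≗ {n} λ d → ⟦⟧-*-cong (b <? d) λ b<d →
           exchangeNumber-independent (β> b (ℕ.≤-<-trans b<d (Fin.toℕ<n d))) b<d) ⟩
    terminalHeight U b + ∑ {n} (λ d → ⟦ b <? d ⟧ * exchangeNumber U b d)
      ≡⟨ total-balance b ⟩
    initialHeight μ b + ∑ {n} (λ a → ⟦ a <? b ⟧ * exchangeNumber U a b)
      ≡⟨ cong₂ _+_ (initialHeight-independent b c) (sum-cong-≗ {n} λ a → ⟦⟧-*-cong (a <? b) λ a<b →
           exchangeNumber-independent a<b (β> a (ℕ.≤-<-trans a<b (Fin.toℕ<n b)))) ⟩
    initialHeight μ c + ∑ {n} (λ a → ⟦ a <? b ⟧ * exchangeNumber U a (β a))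
      ≡⟨ cong (initialHeight μ c +_) (Σ-filter-allFin (_<? b) (λ a → exchangeNumber U a (β a))) ⟨
    initialHeight μ c + sum (map (λ a → exchangeNumber U a (β a)) (filter (_<? b) (allFin n))) ∎
    where
    open ≡-Reasoning
    open Run U std

open import Data.Integer using (+_; _+_; _-_)

theorem4p4 : ∀ (n : ℕ) (μ : Partition n) (U : Tableau μ) → Standard U →
    (β : Fin n → Fin n) → (∀ a → suc (toℕ a) <ℕ n → a < β a) →
    (c b : Fin n) →
    + ((n ∸ suc (toℕ b)) * exchangeNumber U b (β b))
    ≡ + initialHeight μ c - + terminalHeight U b
    + + sum (map (λ a → exchangeNumber U a (β a)) (filter (_<? b) (allFin n)))
theorem4p4 n μ U std β β> c b = solve-for _ _ _ _ (height-recursion U std β β> c b)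
  where
  open Exchanges {n} {μ}
  solve-for : ∀ w x i s → w ℕ.+ x ≡ i ℕ.+ s → + x ≡ + i - + w + + s
  solve-for w x i s eq = begin
    + x                  ≡⟨ isolate (+ w) (+ x) ⟩
    + w + + x - + w      ≡⟨ cong (λ e → + e - + w) eq ⟩
    + i + + s - + w      ≡⟨ reorder (+ i) (+ s) (+ w) ⟩
    + i - + w + + s      ∎
    where
    open ≡-Reasoning
    isolate : ∀ w x → x ≡ w + x - w
    isolate = solve-∀
    reorder : ∀ i s w → i + s - w ≡ i - w + s
    reorder = solve-∀
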